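{- Let $r,s,\ell,k,m$ be positive integers with $r\ge s$, $\ell\ge k$, $r\ge\ell$, $s\ge k$, and $k\ell\le m\le rs$. Let $G=G[U,W]$ be a bipartite graph with parts $U$ and $W$, $|U|=r$, $|W|=s$, and exactly $m$ edges. Suppose that there exists a subset $I\subseteq U$ with $|I|=\ell$ and $\delta_G(I)\ge k$. Then $$N(S_2,G)\le\begin{cases} N\big(S_2,B_1(r,s,m,\ell,k)\big), & \text{if } m\le rk \text{ and } k+\ell\le r,\\ N\big(S_2,B_2(r,s,m,\ell,k)\big), & \text{if } m\le rk \text{ and } k+\ell>r,\\ N\big(S_2,B(r,s,m)\big), & \text{if } m\ge rk.\end{cases}$$
   Context: All graphs are finite and simple. $S_2$ denotes the star with two edges. $N(S_2,G)$ is the number of (not necessarily induced) subgraphs of $G$ isomorphic to $S_2$, i.e. $N(S_2,G)=\sum_{v\in V(G)}\binom{d_G(v)}{2}$, where $d_G(v)$ is the degree of $v$. For $S\subseteq V(G)$, $\delta_G(S)=\min\{d_G(v):v\in S\}$. For a positive integer $t$, $[t]=\{1,\dots,t\}$, $[0]=\emptyset$, and for integers $a\le b$, $[a,b]=\{a,\dots,b\}$, with $[a,b]=\emptyset$ if $a>b$. All of the following bipartite graphs have parts $\{u_1,\dots,u_r\}$ and $\{w_1,\dots,w_s\}$. - $B(r,s,m)$, for $m\le rs$ and $r\ge s$: write $m=rp+q$ with integers $p\ge0$, $0\le q\le r-1$. The edge set is $\{\{u_i,w_j\}:(i,j)\in[r]\times[p]\}\cup\{\{u_i,w_{p+1}\}: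 i\in[q]\}$. - $B_1(r,s,m,\ell,k)$, for $r\ge\ell$, $s\ge k$, $k\ell\le m\le rk$ (used when $r>\ell$): write $m=k\ell+p(r-\ell)+q$ with integers $p\ge0$, $0\le q\le r-\ell-1$. The edge set is the union of $\{\{u_i,w_j\}:(i,j)\in[r]\times[p]\}$, $\{\{u_i,w_{p+1}\}:i\in[\ell+q]\}$ (this second set is omitted if $p=k$, which happens only when $m=rk$), and $\{\{u_i,w_j\}:(i,j)\in[\ell]\times[p+2,k]\}$. - $B_2(r,s,m,\ell,k)$, for $r\ge\ell$, $s\ge k$, $k\ell\le m\le rk$: write $m=k\ell+pk+q$ with integers $p\ge0$, $0\le q\le k-1$. The edge set is $\{\{u_i,w_j\}:(i,j)\in[\ell+p]\times[k]\}\cup\{\{u_{\ell+p+1},w_i\}:i\in[q]\}$. -}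

module Defs where

open import Data.Bool using (Bool; _∧_; _∨_; not; T?)
open import Data.Fin using (Fin; toℕ)
open import Data.Fin.Subset using (Subset; ∣_∣)
open import Data.Fin.Subset.Properties using (_∈?_)
open import Data.List using (List; allFin; cartesianProduct; filter; map)
open import Data.List.Extrema.Nat using (min)
open import Data.Nat
open import Data.Nat.Combinatorics using (_C_)
open import Data.Nat.DivMod using (_/_; _%_)
open import Data.Nat.Properties
  using (+-0-monoid; +-monoˡ-≤; ≤-trans; m<n⇒0<n∸m)
open import Data.Product using (_×_; uncurry)
open import Data.Vec using (tabulate)
open import Algebra.Properties.Monoid.Sum +-0-monoid using (sum-syntax)

infix 7 _∈[_,_]

-- A finite simple bipartite graph with parts U = Fin r and W = Fin s, given
-- by its biadjacency matrix; edges inside a part cannot be expressed.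
record BipartiteGraph (r s : ℕ) : Set where
  constructor mkBipartite
  field
    adj : Fin r → Fin s → Bool

open BipartiteGraph public

module _ {r s : ℕ} (G : BipartiteGraph r s) where

  edges : List (Fin r × Fin s)
  edges = filter (λ e → T? (uncurry (adj G) e))
                 (cartesianProduct (allFin r) (allFin s))

  degU : Fin r → ℕ
  degU u = ∣ tabulate (λ w → adj G u w) ∣

  degW : Fin s → ℕ
  degW w = ∣ tabulate (λ u → adj G u w) ∣

  -- Minimum degree over a set of vertices of U.  The first argument of min is
  -- the value for an empty list; as every degree in U is at most s, it does
  -- not affect the minimum over a nonempty set.
  δU : Subset r → ℕ
  δU S = min s (map degU (filter (_∈? S) (allFin r)))

  -- The number of subgraphs isomorphic to the two-edge star S₂, counted by
  -- their centre, which ranges over both parts.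
  N-S₂ : ℕ
  N-S₂ = (∑[ u < r ] (degU u C 2))
       + (∑[ w < s ] (degW w C 2))

-- Membership in the integer interval [a,b], which is empty if a > b.
_∈[_,_] : ℕ → ℕ → ℕ → Bool
i ∈[ a , b ] = (a ≤ᵇ i) ∧ (i ≤ᵇ b)

-- The bipartite graph with parts {u₁,…,u_r} and {w₁,…,w_s} in which u_i w_j is
-- an edge when E i j holds; indices start at 1, so u_i is the element i ∸ 1
-- of Fin r.
fromIndices : ∀ r s → (ℕ → ℕ → Bool) → BipartiteGraph r s
fromIndices r s E = mkBipartite (λ u w → E (suc (toℕ u)) (suc (toℕ w)))

-- Here m = r p + q with 0 ≤ q ≤ r - 1.
B : (r s m : ℕ) .{{_ : NonZero r}} → BipartiteGraph r s
B r s m = fromIndices r s λ i j →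
    (i ∈[ 1 , r ] ∧ j ∈[ 1 , p ])
  ∨ (i ∈[ 1 , q ] ∧ (j ≡ᵇ p + 1))
  where
  p = m / r
  q = m % r

-- Here m = k ℓ + p (r - ℓ) + q with 0 ≤ q ≤ r - ℓ - 1.  Meaningful only for
-- s ≥ k and k ℓ ≤ m ≤ r k.
B₁ : (r s m ℓ k : ℕ) → ℓ < r → BipartiteGraph r s
B₁ r s m ℓ k ℓ<r = fromIndices r s λ i j →
    (i ∈[ 1 , r ] ∧ j ∈[ 1 , p ])
  ∨ (not (p ≡ᵇ k) ∧ i ∈[ 1 , ℓ + q ] ∧ (j ≡ᵇ p + 1))
  ∨ (i ∈[ 1 , ℓ ] ∧ j ∈[ p + 2 , k ])
  where
  instance
    r∸ℓ≢0 : NonZero (r ∸ ℓ)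
    r∸ℓ≢0 = >-nonZero (m<n⇒0<n∸m ℓ<r)
  p = (m ∸ k * ℓ) / (r ∸ ℓ)
  q = (m ∸ k * ℓ) % (r ∸ ℓ)

-- Here m = k ℓ + p k + q with 0 ≤ q ≤ k - 1.  Meaningful only for r ≥ ℓ, s ≥ k
-- and k ℓ ≤ m ≤ r k.
B₂ : (r s m ℓ k : ℕ) .{{_ : NonZero k}} → BipartiteGraph r s
B₂ r s m ℓ k = fromIndices r s λ i j →
    (i ∈[ 1 , ℓ + p ] ∧ j ∈[ 1 , k ])
  ∨ ((i ≡ᵇ ℓ + p + 1) ∧ j ∈[ 1 , q ])
  where
  p = (m ∸ k * ℓ) / k
  q = (m ∸ k * ℓ) % k

k+ℓ≤r⇒ℓ<r : ∀ {k ℓ r} .{{_ : NonZero k}} → k + ℓ ≤ r → ℓ < r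
k+ℓ≤r⇒ℓ<r {k} {ℓ} k+ℓ≤r = ≤-trans (+-monoˡ-≤ ℓ (>-nonZero⁻¹ k)) k+ℓ≤r

{-# OPTIONS --safe #-}
module Submission where

-- With rows and columns numbered from 0, a Ferrers diagram has Σ (i + j) over
-- its cells (i , j) as its number of two-edge stars, and a bipartite graph with
-- row degrees a₀ ≥ a₁ ≥ … has at most as many as the diagram with these rows.
-- Filling columns of height n with m cells gives packed n m.  Any diagram inside
-- an n × n box is at most that: by induction on its first row of length a, which
-- is peeled off if there are fewer than a further rows, and is otherwise inserted
-- into packed columns.  If a diagram contains the ℓ × k block, let ℓ′ ≥ ℓ be the
-- number of its rows of length at least k.  Its cells outside the ℓ′ × k block lie
-- to the right of that block or below it; both parts are packed, the right part is
-- moved down using ℓ′ ≥ k, and the two are merged by superadditivity of packed n.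
-- Giving the last ℓ′ - ℓ rows of the block back to the part below does not decrease
-- the bound, as each of them can be inserted into packed columns.

open import Defs
open import Data.Bool using (Bool; true; false; T?; if_then_else_; not; _∧_; _∨_)
open import Data.Bool.Properties using (T-≡)
open import Data.Fin using (Fin; zero; suc; toℕ)
open import Data.Fin.Subset using (Subset; ∣_∣; _∈_)
open import Data.Fin.Subset.Properties using (_∈?_; ∣p∣≤n)
open import Data.List using (List; []; _∷_; _++_; length; map; filter; allFin; tabulate; cartesianProduct)
open import Data.List.Extrema.Nat using (min≤xs)
open import Data.List.Membership.Propositional.Properties using (∈-map⁺; ∈-filter⁺; ∈-allFin)
open import Data.List.Properties
  using (length-++; length-map; length-tabulate; map-++; map-∘; map-id-local; map-tabulate;
         tabulate-cong; filter-++; filter-accept; filter-reject)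
open import Data.List.Relation.Binary.Permutation.Propositional as Perm using (_↭_; prep; swap; ↭-sym; ↭-trans)
open import Data.List.Relation.Binary.Permutation.Propositional.Properties using (All-resp-↭; ↭-length; map⁺; shift)
open import Data.List.Relation.Unary.All as All using (All; []; _∷_)
open import Data.List.Relation.Unary.All.Properties using (all-filter; filter⁺; tabulate⁺)
open import Data.List.Relation.Unary.AllPairs using (AllPairs; []; _∷_)
open import Data.List.Relation.Unary.Sorted.TotalOrder.Properties using (Sorted⇒AllPairs)
import Data.List.Sort as Sort
open import Data.Nat
  using (ℕ; zero; suc; NonZero; _+_; _*_; _∸_; _≤_; _<_; _≥_; _>_; _⊔_; _⊓_; z≤n; s≤s; z<s; s<s;
         >-nonZero; >-nonZero⁻¹; _≤?_; _<?_; _≤′_; ≤′-reflexive; ≤′-step; _≤ᵇ_; _≡ᵇ_)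
open import Data.Nat.Combinatorics using (_C_; nC1≡n; nCk+nC[k+1]≡[n+1]C[k+1])
open import Data.Nat.Divisibility using (∣-refl)
open import Data.Nat.DivMod
open import Data.Nat.ListAction using (sum)
open import Data.Nat.ListAction.Properties using (sum-++; sum-↭)
open import Data.Nat.Properties
open import Algebra.Properties.Semiring.Sum +-*-semiring
  using (∑-comm; ∑-distrib-+; sum-cong-≗; *-distribˡ-sum; sum-syntax)
open import Data.Nat.Tactic.RingSolver using (solve-∀)
open import Data.Product using (_×_; _,_; ∃-syntax; uncurry)
open import Data.Sum using (_⊎_; inj₁; inj₂)
open import Data.Vec as Vec using ([]; _∷_)
open import Function using (_∘_; id; Equivalence)
open import Relation.Binary.Bundles using (DecTotalOrder)
import Relation.Binary.Construct.Flip.EqAndOrd as Flip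
open import Relation.Binary.Definitions using (tri<; tri≈; tri>)
open import Relation.Binary.PropositionalEquality
open import Relation.Nullary using (yes; no; ¬?)
open import Relation.Unary using (Pred; Decidable)

-- Binomial coefficients and packed columns

tri : ℕ → ℕ
tri zero    = 0
tri (suc n) = n + tri n

tri≡C2 : ∀ n → n C 2 ≡ tri n
tri≡C2 zero    = refl
tri≡C2 (suc n) = trans (sym (nCk+nC[k+1]≡[n+1]C[k+1] n 1)) (cong₂ _+_ (nC1≡n n) (tri≡C2 n))

tri-+ : ∀ m n → tri (m + n) ≡ tri m + tri n + m * n
tri-+ zero    n = sym (+-identityʳ (tri n))
tri-+ (suc m) n rewrite tri-+ m n = identity m n (tri m) (tri n)
  where
  identity : ∀ m n a b → m + n + (a + b + m * n) ≡ m + a + b + (n + m * n)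
  identity = solve-∀

tri-mono-≤ : ∀ {m n} → m ≤ n → tri m ≤ tri n
tri-mono-≤ z≤n       = z≤n
tri-mono-≤ (s≤s m≤n) = +-mono-≤ m≤n (tri-mono-≤ m≤n)

-- Naming the slack `d` turns a polynomial inequality into an identity for the ring solver.
≤-diff : ∀ {m n} d → n ≡ m + d → m ≤ n
≤-diff d refl = m≤m+n _ d

-- When columns of height `n` are filled one after another, cell number `x`, counted from 0, lies in
-- column `x / n` and row `x % n`.
weight : ∀ n → .{{NonZero n}} → ℕ → ℕ
weight n x = x / n + x % n

packed : ∀ n → .{{NonZero n}} → ℕ → ℕ
packed n zero    = 0
packed n (suc m) = weight n m + packed n m

packed-mono-≤ : ∀ n .{{_ : NonZero n}} {x y} → x ≤ y → packed n x ≤ packed n y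
packed-mono-≤ n x≤y = go (≤⇒≤′ x≤y)
  where
  go : ∀ {x y} → x ≤′ y → packed n x ≤ packed n y
  go (≤′-reflexive refl) = ≤-refl
  go (≤′-step x≤y)       = ≤-trans (go x≤y) (m≤n+m _ _)

packed-small : ∀ n .{{_ : NonZero n}} {m} → m ≤ n → packed n m ≡ tri m
packed-small n {zero}  m≤n = refl
packed-small n {suc m} m<n = cong₂ _+_
  (cong₂ _+_ (m<n⇒m/n≡0 m<n) (m<n⇒m%n≡m m<n)) (packed-small n (<⇒≤ m<n))

weight-peel : ∀ n .{{_ : NonZero n}} m → weight n (n + m) ≡ suc (weight n m)
weight-peel n m rewrite +-comm n m = cong₂ _+_
  (trans (+-distrib-/-∣ʳ m {n} ∣-refl) (trans (cong (m / n +_) (n/n≡1 n)) (+-comm (m / n) 1)))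
  ([m+n]%n≡m%n m n)

-- The first `n` cells form a full column worth `tri n`; the other `m` repeat the filling one column
-- further right, so each of their weights grows by 1.
packed-peel : ∀ n .{{_ : NonZero n}} m → packed n (n + m) ≡ tri n + m + packed n m
packed-peel n zero    rewrite +-identityʳ n = trans (packed-small n ≤-refl) (identity (tri n))
  where
  identity : ∀ a → a ≡ a + 0 + 0
  identity = solve-∀
packed-peel n (suc m) rewrite +-suc n m | weight-peel n m | packed-peel n m =
  identity (weight n m) (tri n) m (packed n m)
  where
  identity : ∀ w a m b → 1 + w + (a + m + b) ≡ a + (1 + m) + (w + b)
  identity = solve-∀

-- Counting by centres: `p` full columns and one of height `q` give `p * tri n + tri q`; `n` rows of
-- length `p`, of which `q` get one more cell, give `n * tri p + p * q`.
packed-blocks : ∀ n .{{_ : NonZero n}} p {q} → q ≤ n →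
  packed n (p * n + q) ≡ p * tri n + n * tri p + tri q + p * q
packed-blocks n zero {q} q≤n rewrite packed-small n q≤n = identity n (tri q)
  where
  identity : ∀ n a → a ≡ n * 0 + a + 0
  identity = solve-∀
packed-blocks n (suc p) {q} q≤n
  rewrite +-assoc n (p * n) q | packed-peel n (p * n + q) | packed-blocks n p q≤n =
  identity n p q (tri n) (tri p) (tri q)
  where
  identity : ∀ n p q a b c → a + (p * n + q) + (p * a + n * b + c + p * q)
                           ≡ (1 + p) * a + n * (p + b) + c + (1 + p) * q
  identity = solve-∀

m≡[m/n]*n+m%n : ∀ m n .{{_ : NonZero n}} → m ≡ m / n * n + m % n
m≡[m/n]*n+m%n m n = trans (m≡m%n+[m/n]*n m n) (+-comm (m % n) _)

block-induction : ∀ n .{{_ : NonZero n}} (P : ℕ → Set) →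
  (∀ {q} → q < n → P q) → (∀ m → P m → P (n + m)) → ∀ m → P m
block-induction n P base step m = subst P (sym (m≡[m/n]*n+m%n m n)) (go (m / n))
  where
  go : ∀ p → P (p * n + m % n)
  go zero    = base (m%n<n m n)
  go (suc p) = subst P (sym (+-assoc n (p * n) _)) (step _ (go p))

-- One full column of height `suc n` is peeled at a time. On the right only `n` cells are peeled
-- with it, and monotonicity of `packed n` drops the one left over.
packed-suc-≤ : ∀ n .{{_ : NonZero n}} y → packed (suc n) y ≤ y + packed n y
packed-suc-≤ n = block-induction (suc n) _ base step
  where
  base : ∀ {q} → q < suc n → packed (suc n) q ≤ q + packed n q
  base {q} q<1+n rewrite packed-small (suc n) (<⇒≤ q<1+n) | packed-small n (≤-pred q<1+n) = m≤n+m _ q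
  identity : ∀ n m a b → 1 + n + m + (a + (1 + m) + b) ≡ n + a + m + (m + b) + 2
  identity = solve-∀
  open ≤-Reasoning
  step : ∀ m → packed (suc n) m ≤ m + packed n m →
         packed (suc n) (suc n + m) ≤ suc n + m + packed n (suc n + m)
  step m ih = begin
    packed (suc n) (suc n + m)                  ≡⟨ packed-peel (suc n) m ⟩
    tri (suc n) + m + packed (suc n) m          ≤⟨ +-monoʳ-≤ (tri (suc n) + m) ih ⟩
    n + tri n + m + (m + packed n m)            ≤⟨ ≤-diff 2 (identity n m (tri n) (packed n m)) ⟩
    suc n + m + (tri n + suc m + packed n m)    ≤⟨ +-monoʳ-≤ (suc n + m) (+-monoʳ-≤ (tri n + suc m) (packed-mono-≤ n (n≤1+n m))) ⟩
    suc n + m + (tri n + suc m + packed n (suc m)) ≡⟨ cong (suc n + m +_) (packed-peel n (suc m)) ⟨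
    suc n + m + packed n (n + suc m)            ≡⟨ cong (λ x → suc n + m + packed n x) (+-suc n m) ⟩
    suc n + m + packed n (suc n + m)            ∎

packed-+-≤ : ∀ n .{{_ : NonZero n}} d y → packed (d + n) {{>-nonZero (m≤n⇒m≤o+n d (>-nonZero⁻¹ n))}} y ≤ d * y + packed n y
packed-+-≤ n zero    y = ≤-refl
packed-+-≤ n (suc d) y = begin
  packed (suc d + n) y      ≤⟨ packed-suc-≤ (d + n) y ⟩
  y + packed (d + n) y      ≤⟨ +-monoʳ-≤ y (packed-+-≤ n d y) ⟩
  y + (d * y + packed n y)  ≡⟨ +-assoc y (d * y) _ ⟨
  suc d * y + packed n y    ∎
  where
  open ≤-Reasoning
  instance
    d+n≢0 : NonZero (d + n)
    d+n≢0 = >-nonZero (m≤n⇒m≤o+n d (>-nonZero⁻¹ n))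

-- Full columns are peeled from `x` and then from `y`: on the right each of them shifts all other
-- cells, on the left only those of its own summand. Two partial columns remain, which `convexity`
-- merges.
packed-superadditive : ∀ n .{{_ : NonZero n}} x y → packed n x + packed n y ≤ packed n (x + y)
packed-superadditive n = block-induction n _ baseˡ stepˡ
  where
  open ≤-Reasoning
  Superadditive : ℕ → ℕ → Set
  Superadditive x y = packed n x + packed n y ≤ packed n (x + y)

  stepˡ : ∀ x → (∀ y → Superadditive x y) → ∀ y → Superadditive (n + x) y
  stepˡ x ih y = begin
    packed n (n + x) + packed n y                ≡⟨ cong (_+ packed n y) (packed-peel n x) ⟩
    tri n + x + packed n x + packed n y          ≡⟨ +-assoc (tri n + x) _ _ ⟩
    tri n + x + (packed n x + packed n y)        ≤⟨ +-mono-≤ (+-monoʳ-≤ (tri n) (m≤m+n x y)) (ih y) ⟩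
    tri n + (x + y) + packed n (x + y)           ≡⟨ packed-peel n (x + y) ⟨
    packed n (n + (x + y))                       ≡⟨ cong (packed n) (+-assoc n x y) ⟨
    packed n (n + x + y)                         ∎

  -- Of two columns with more than `n` cells together, `i` cells of the second complete the first to
  -- height `n`, and the other `z` start a new column.
  wrap : ∀ z w i → z + w + i ≡ n → tri (z + w) + tri (i + z) ≤ packed n (n + z)
  wrap z w i z+w+i≡n = begin
    tri (z + w) + tri (i + z)                    ≡⟨ cong (tri (z + w) +_) (tri-+ i z) ⟩
    tri (z + w) + (tri i + tri z + i * z)        ≤⟨ ≤-diff (w * i + z) (identity (tri (z + w)) (tri i) (tri z) z w i) ⟩
    tri (z + w) + tri i + (z + w) * i + z + tri z ≡⟨ cong (λ t → t + z + tri z) (tri-+ (z + w) i) ⟨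
    tri (z + w + i) + z + tri z                  ≡⟨ cong (λ t → tri t + z + tri z) z+w+i≡n ⟩
    tri n + z + tri z                            ≡⟨ cong (tri n + z +_) (packed-small n z≤n′) ⟨
    tri n + z + packed n z                       ≡⟨ packed-peel n z ⟨
    packed n (n + z)                             ∎
    where
    z≤n′ : z ≤ n
    z≤n′ = ≤-trans (m≤m+n z w) (≤-trans (m≤m+n (z + w) i) (≤-reflexive z+w+i≡n))
    identity : ∀ a b c z w i → a + b + (z + w) * i + z + c ≡ a + (b + c + i * z) + (w * i + z)
    identity = solve-∀

  convexity : ∀ x y → x < n → y < n → tri x + tri y ≤ packed n (x + y)
  convexity x y x<n y<n with x + y ≤? n
  ... | yes x+y≤n = begin
    tri x + tri y          ≤⟨ m≤m+n _ (x * y) ⟩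
    tri x + tri y + x * y  ≡⟨ tri-+ x y ⟨
    tri (x + y)            ≡⟨ packed-small n x+y≤n ⟨
    packed n (x + y)       ∎
  ... | no  x+y≰n = begin
    tri x + tri y              ≡⟨ cong₂ (λ a b → tri a + tri b) z+w≡x i+z≡y ⟨
    tri (z + w) + tri (i + z)  ≤⟨ wrap z w i (trans (cong (_+ i) z+w≡x) x+i≡n) ⟩
    packed n (n + z)           ≡⟨ cong (packed n) n+z≡x+y ⟩
    packed n (x + y)           ∎
    where
    i = n ∸ x
    z = y ∸ i
    w = x ∸ z
    x+i≡n : x + i ≡ n
    x+i≡n = m+[n∸m]≡n (<⇒≤ x<n)
    i≤y : i ≤ y
    i≤y = m≤n+o⇒m∸n≤o n x (<⇒≤ (≰⇒> x+y≰n))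
    i+z≡y : i + z ≡ y
    i+z≡y = m+[n∸m]≡n i≤y
    n+z≡x+y : n + z ≡ x + y
    n+z≡x+y = trans (cong (_+ z) (sym x+i≡n)) (trans (+-assoc x i z) (cong (x +_) i+z≡y))
    -- Here `z` is at most `x` because `y < n` and `n` equals `x + i`.
    z+w≡x : z + w ≡ x
    z+w≡x = m+[n∸m]≡n (m≤n+o⇒m∸n≤o y i (≤-trans (<⇒≤ y<n) (≤-reflexive (trans (sym x+i≡n) (+-comm x i)))))

  baseˡ : ∀ {x} → x < n → ∀ y → Superadditive x y
  baseˡ {x} x<n = block-induction n _ base step
    where
    base : ∀ {y} → y < n → Superadditive x y
    base {y} y<n rewrite packed-small n (<⇒≤ x<n) | packed-small n (<⇒≤ y<n) = convexity x y x<n y<n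
    step : ∀ y → Superadditive x y → Superadditive x (n + y)
    step y ih = begin
      packed n x + packed n (n + y)          ≡⟨ +-comm (packed n x) _ ⟩
      packed n (n + y) + packed n x          ≡⟨ cong (_+ packed n x) (packed-peel n y) ⟩
      tri n + y + packed n y + packed n x    ≡⟨ +-assoc (tri n + y) _ _ ⟩
      tri n + y + (packed n y + packed n x)  ≡⟨ cong (tri n + y +_) (+-comm (packed n y) _) ⟩
      tri n + y + (packed n x + packed n y)  ≤⟨ +-mono-≤ (+-monoʳ-≤ (tri n) (m≤n+m y x)) ih ⟩
      tri n + (x + y) + packed n (x + y)     ≡⟨ packed-peel n (x + y) ⟨
      packed n (n + (x + y))                 ≡⟨ cong (packed n) (exchange n x y) ⟩
      packed n (x + (n + y))                 ∎
      where
      exchange : ∀ n x y → n + (x + y) ≡ x + (n + y)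
      exchange = solve-∀

-- Changing the column height and inserting a row

private
  module _ (n : ℕ) .{{_ : NonZero n}} where
    open ≤-Reasoning

    -- The remainder `p + z` supplies the one cell by which each of the `p` full columns grows, and
    -- `z` cells are left over.
    no-borrow : ∀ p z w → p + z + w ≡ n →
      packed n (p * n + (p + z)) ≤ packed (suc n) (p * n + (p + z))
    no-borrow p z w refl = begin
      packed n (p * n + (p + z))                                          ≡⟨ packed-blocks n p (m≤m+n (p + z) w) ⟩
      p * tri n + n * tri p + tri (p + z) + p * (p + z)                   ≡⟨ cong (λ t → p * tri n + n * tri p + t + p * (p + z)) (tri-+ p z) ⟩
      p * tri n + n * tri p + (tri p + tri z + p * z) + p * (p + z)       ≤⟨ ≤-diff (p * w) (identity p z w (tri n) (tri p) (tri z)) ⟩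
      p * tri (suc n) + suc n * tri p + tri z + p * z                     ≡⟨ packed-blocks (suc n) p (m≤n⇒m≤1+n (≤-trans (m≤n+m z p) (m≤m+n (p + z) w))) ⟨
      packed (suc n) (p * suc n + z)                                      ≡⟨ cong (packed (suc n)) (size p n z) ⟩
      packed (suc n) (p * n + (p + z))                                    ∎
      where
      size : ∀ p n z → p * (1 + n) + z ≡ p * n + (p + z)
      size = solve-∀
      identity : ∀ p z w t a c →
        p * ((p + z + w) + t) + (1 + (p + z + w)) * a + c + p * z
        ≡ p * t + (p + z + w) * a + (a + c + p * z) + p * (p + z) + p * w
      identity = solve-∀

    -- The remainder `q` is too small to raise all `suc (q + z)` columns, so one of them is broken
    -- up. Raising the other `q + z` leaves `n + q - (q + z)` cells, which is `y` below.
    borrow : ∀ q z w → suc (q + z) + w ≡ n →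
      packed n (suc (q + z) * n + q) ≤ packed (suc n) (suc (q + z) * n + q)
    borrow q z w refl = begin
      packed n (p * n + q)                                               ≡⟨ packed-blocks n p q≤n ⟩
      p * tri n + n * (q + z + tri (q + z)) + tri q + p * q              ≡⟨ cong₂ (λ t u → p * t + n * (q + z + u) + tri q + p * q) tri-n (tri-+ q z) ⟩
      p * (tri z + tri y + z * y) + n * (q + z + (tri q + tri z + q * z)) + tri q + p * q
                                                                         ≤⟨ ≤-diff (q * w) (identity q z w (tri q) (tri z) (tri y)) ⟩
      (q + z) * (n + (tri z + tri y + z * y)) + suc n * (tri q + tri z + q * z) + tri y + (q + z) * y
                                                                         ≡⟨ cong₂ (λ t u → (q + z) * (n + t) + suc n * u + tri y + (q + z) * y) tri-n (tri-+ q z) ⟨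
      (q + z) * tri (suc n) + suc n * tri (q + z) + tri y + (q + z) * y  ≡⟨ packed-blocks (suc n) (q + z) (m≤n⇒m≤1+n y≤n) ⟨
      packed (suc n) ((q + z) * suc n + y)                               ≡⟨ cong (packed (suc n)) (size q z w) ⟩
      packed (suc n) (p * n + q)                                         ∎
      where
      p = suc (q + z)
      y = suc (q + w)
      n≡z+y : ∀ q z w → 1 + (q + z) + w ≡ z + (1 + (q + w))
      n≡z+y = solve-∀
      y≤n : y ≤ n
      y≤n = ≤-trans (m≤n+m y z) (≤-reflexive (sym (n≡z+y q z w)))
      q≤n : q ≤ n
      q≤n = ≤-trans (m≤n⇒m≤1+n (m≤m+n q w)) y≤n
      tri-n : tri n ≡ tri z + tri y + z * y
      tri-n = trans (cong tri (n≡z+y q z w)) (tri-+ z y)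
      size : ∀ q z w → (q + z) * (1 + (1 + (q + z) + w)) + (1 + (q + w)) ≡ (1 + (q + z)) * (1 + (q + z) + w) + q
      size = solve-∀
      identity : ∀ q z w a c d →
        (q + z) * (1 + (q + z) + w + (c + d + z * (1 + (q + w)))) + (1 + (1 + (q + z) + w)) * (a + c + q * z) + d + (q + z) * (1 + (q + w))
        ≡ (1 + (q + z)) * (c + d + z * (1 + (q + w))) + (1 + (q + z) + w) * (q + z + (a + c + q * z)) + a + (1 + (q + z)) * q + q * w
      identity = solve-∀

-- The bound on `m` allows at most `n` full columns, so the filling is no wider than it is high, and
-- making it higher does no harm. The split is on whether the remainder can raise every full column.
packed-≤-suc : ∀ n .{{_ : NonZero n}} {m} → m ≤ n * n → packed n m ≤ packed (suc n) m
packed-≤-suc n {m} m≤n² = subst (λ x → packed n x ≤ packed (suc n) x) (sym (m≡[m/n]*n+m%n m n)) blocks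
  where
  p≤n : m / n ≤ n
  p≤n = *-cancelʳ-≤ (m / n) n n (≤-trans (m/n*n≤m m n) m≤n²)
  blocks : packed n (m / n * n + m % n) ≤ packed (suc n) (m / n * n + m % n)
  blocks with m / n | m % n | m%n<n m n | p≤n
  ... | p | q | q<n | p≤n with p ≤? q
  ... | yes p≤q with z , refl ← m≤n⇒∃[o]m+o≡n p≤q =
    no-borrow n p z (n ∸ (p + z)) (m+[n∸m]≡n (<⇒≤ q<n))
  ... | no p≰q with z , refl ← m≤n⇒∃[o]m+o≡n (≰⇒> p≰q) =
    borrow n q z (n ∸ suc (q + z)) (m+[n∸m]≡n p≤n)

packed-monoʰ-≤ : ∀ {a b} .{{_ : NonZero a}} .{{_ : NonZero b}} {m} → a ≤ b → m ≤ a * a → packed a m ≤ packed b m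
packed-monoʰ-≤ a≤b = go (≤⇒≤′ a≤b)
  where
  go : ∀ {a b} .{{_ : NonZero a}} .{{_ : NonZero b}} {m} → a ≤′ b → m ≤ a * a → packed a m ≤ packed b m
  go (≤′-reflexive refl) m≤a² = ≤-refl
  go {a} (≤′-step {b} a≤b) m≤a² =
    ≤-trans (go a≤b m≤a²) (packed-≤-suc b (≤-trans m≤a² (*-mono-≤ (≤′⇒≤ a≤b) (≤′⇒≤ a≤b))))
    where
    instance
      b≢0 : NonZero b
      b≢0 = >-nonZero (≤-trans (>-nonZero⁻¹ a) (≤′⇒≤ a≤b))

-- The left side counts a row of length `k` on top of packed columns: `tri k` for the row, and one
-- extra for each of the `f` cells pushed down. As `f ≤ n * k`, nothing sticks out beyond the row,
-- and columns can be peeled until only a hook is left.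
insert-row : ∀ n .{{_ : NonZero n}} {k f} → k ≤ n → f ≤ n * k →
  tri k + f + packed n f ≤ packed (suc n) (k + f)
insert-row n {zero}  {f} k≤n f≤0 with refl ← n≤0⇒n≡0 (≤-trans f≤0 (≤-reflexive (*-zeroʳ n))) = z≤n
insert-row n {suc k} {f} k<n f≤n*[1+k] with n ≤? f
-- A full column of height `n` and the row cell above it form a full column of height `suc n`.
... | yes n≤f with g , refl ← m≤n⇒∃[o]m+o≡n n≤f = begin
    k + tri k + (n + g) + packed n (n + g)              ≡⟨ cong (k + tri k + (n + g) +_) (packed-peel n g) ⟩
    k + tri k + (n + g) + (tri n + g + packed n g)      ≡⟨ identity n k g (tri k) (tri n) (packed n g) ⟩
    n + tri n + (k + g) + (tri k + g + packed n g)      ≤⟨ +-monoʳ-≤ (n + tri n + (k + g)) (insert-row n (<⇒≤ k<n) g≤n*k) ⟩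
    tri (suc n) + (k + g) + packed (suc n) (k + g)      ≡⟨ packed-peel (suc n) (k + g) ⟨
    packed (suc n) (suc n + (k + g))                    ≡⟨ cong (packed (suc n)) (size n k g) ⟩
    packed (suc n) (suc k + (n + g))                    ∎
  where
  open ≤-Reasoning
  g≤n*k : g ≤ n * k
  g≤n*k = +-cancelˡ-≤ n _ _ (≤-trans f≤n*[1+k] (≤-reflexive (*-suc n k)))
  size : ∀ n k g → 1 + n + (k + g) ≡ 1 + k + (n + g)
  size = solve-∀
  identity : ∀ n k g a b c → k + a + (n + g) + (b + g + c) ≡ n + b + (k + g) + (a + g + c)
  identity = solve-∀
... | no n≰f with suc k + f ≤? suc n
-- The hook consists of the row and one partial column below it; here all its cells fit into one
-- column.
... | yes fits = begin
    tri (suc k) + f + packed n f         ≡⟨ cong (tri (suc k) + f +_) (packed-small n (<⇒≤ (≰⇒> n≰f))) ⟩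
    tri (suc k) + f + tri f              ≤⟨ ≤-diff (k * f) (identity k f (tri (suc k)) (tri f)) ⟩
    tri (suc k) + tri f + suc k * f      ≡⟨ tri-+ (suc k) f ⟨
    tri (suc k + f)                      ≡⟨ packed-small (suc n) fits ⟨
    packed (suc n) (suc k + f)           ∎
  where
  open ≤-Reasoning
  identity : ∀ k f a b → a + b + (1 + k) * f ≡ a + f + b + k * f
  identity = solve-∀
-- The hook fills a column of height `suc n` and puts `g`, that is `k + f - n`, cells into a second
-- one.
... | no overflows = begin
    tri (suc k) + f + packed n f                    ≡⟨ cong (tri (suc k) + f +_) (packed-small n (<⇒≤ f<n)) ⟩
    tri (suc k) + f + tri f                         ≡⟨ cong (λ x → tri (suc k) + x + tri x) g+i≡f ⟨
    tri (suc k) + (suc g + i) + tri (suc g + i)     ≡⟨ cong (λ x → tri (suc k) + (suc g + i) + x) (tri-+ (suc g) i) ⟩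
    tri (suc k) + (suc g + i) + (g + tri g + tri i + suc g * i)
      ≡⟨ cong (λ x → tri x + (suc g + i) + (g + tri g + tri i + suc g * i)) g+j≡k ⟨
    tri (suc g + j) + (suc g + i) + (g + tri g + tri i + suc g * i)
      ≤⟨ ≤-diff (j * suc i) (identity g i j (tri (suc g + j)) (tri g) (tri i)) ⟩
    suc g + j + i + (tri (suc g + j) + tri i + (suc g + j) * i) + g + tri g
      ≡⟨ cong (λ x → x + i + (tri x + tri i + x * i) + g + tri g) g+j≡k ⟩
    suc k + i + (tri (suc k) + tri i + suc k * i) + g + tri g ≡⟨ cong (λ x → suc k + i + x + g + tri g) (tri-+ (suc k) i) ⟨
    suc k + i + tri (suc k + i) + g + tri g         ≡⟨ cong (λ x → x + tri x + g + tri g) k+i≡n ⟩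
    tri (suc n) + g + tri g                         ≡⟨ cong (tri (suc n) + g +_) (packed-small (suc n) g≤1+n) ⟨
    tri (suc n) + g + packed (suc n) g              ≡⟨ packed-peel (suc n) g ⟨
    packed (suc n) (suc n + g)                      ≡⟨ cong (packed (suc n)) size ⟩
    packed (suc n) (suc k + f)                      ∎
  where
  open ≤-Reasoning
  f<n : f < n
  f<n = ≰⇒> n≰f
  i = n ∸ suc k
  k+i≡n : suc k + i ≡ n
  k+i≡n = m+[n∸m]≡n k<n
  1+i≤f : suc i ≤ f
  1+i≤f = +-cancelˡ-≤ (suc k) _ _ (≤-trans (≤-reflexive (trans (+-suc (suc k) i) (cong suc k+i≡n))) (<⇒≤ (≰⇒> overflows)))
  g = f ∸ suc i
  g+i≡f : suc g + i ≡ f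
  g+i≡f = trans (+-comm (suc g) i) (trans (+-suc i g) (m+[n∸m]≡n 1+i≤f))
  1+g≤1+k : suc g ≤ suc k
  1+g≤1+k = +-cancelʳ-≤ i _ _ (≤-trans (≤-reflexive g+i≡f) (≤-trans (<⇒≤ f<n) (≤-reflexive (sym k+i≡n))))
  j = k ∸ g
  g+j≡k : suc g + j ≡ suc k
  g+j≡k = cong suc (m+[n∸m]≡n (≤-pred 1+g≤1+k))
  g≤1+n : g ≤ suc n
  g≤1+n = m≤n⇒m≤1+n (≤-trans (≤-trans (m∸n≤m f (suc i)) (<⇒≤ f<n)) ≤-refl)
  regroup : ∀ k i g → 1 + (1 + k + i) + g ≡ 1 + k + (1 + g + i)
  regroup = solve-∀
  size : suc n + g ≡ suc k + f
  size = trans (cong (λ x → suc x + g) (sym k+i≡n)) (trans (regroup k i g) (cong (suc k +_) g+i≡f))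
  identity : ∀ g i j a b c → 1 + g + j + i + (a + c + (1 + g + j) * i) + g + b
    ≡ a + (1 + g + i) + (g + b + c + (1 + g) * i) + j * (1 + i)
  identity = solve-∀

-- Star bound for degree sequences in a square box

-- The reversed order makes `sort` return the rows of a Ferrers diagram, longest first.
≥-decTotalOrder : DecTotalOrder _ _ _
≥-decTotalOrder = Flip.decTotalOrder ≤-decTotalOrder

open Sort ≥-decTotalOrder using (sort; sort-↭; sort-↗)

shared : ℕ → List ℕ → ℕ
shared a as = sum (map (a ⊓_) as)

-- The largest number of two-edge stars in a bipartite graph whose degrees on
-- one side are as: neighbourhoods of sizes a and b share at most a ⊓ b vertices.
stars : List ℕ → ℕ
stars []       = 0
stars (a ∷ as) = tri a + shared a as + stars as

-- Apart from the terms `tri a`, each unordered pair of entries contributes its minimum, and this is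
-- symmetric.
stars-↭ : ∀ {as bs} → as ↭ bs → stars as ≡ stars bs
stars-↭ Perm.refl         = refl
stars-↭ (prep a p)   = cong₂ _+_ (cong (tri a +_) (sum-↭ (map⁺ (a ⊓_) p))) (stars-↭ p)
stars-↭ (Perm.trans p q)  = trans (stars-↭ p) (stars-↭ q)
stars-↭ {as = _ ∷ _ ∷ as} {bs = _ ∷ _ ∷ bs} (swap a b p)
  rewrite ⊓-comm b a | sum-↭ (map⁺ (a ⊓_) p) | sum-↭ (map⁺ (b ⊓_) p) | stars-↭ p =
  identity (tri a) (tri b) (a ⊓ b) (shared a bs) (shared b bs) (stars bs)
  where
  identity : ∀ a b m x y s → a + (m + x) + (b + y + s) ≡ b + (m + y) + (a + x + s)
  identity = solve-∀

shared-max : ∀ {a as} → All (_≤ a) as → shared a as ≡ sum as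
shared-max []           = refl
shared-max (b≤a ∷ bs≤a) = cong₂ _+_ (m≥n⇒m⊓n≡n b≤a) (shared-max bs≤a)

sum-≤ : ∀ {n as} → All (_≤ n) as → sum as ≤ length as * n
sum-≤ []           = z≤n
sum-≤ (a≤n ∷ as≤n) = +-mono-≤ a≤n (sum-≤ as≤n)

stars-descending : ∀ n .{{_ : NonZero n}} {as} → AllPairs _≥_ as → length as ≤ n → All (_≤ n) as →
  stars as ≤ packed n (sum as)
stars-descending n [] _ _ = z≤n
stars-descending n {a ∷ as} (as≤a ∷ desc) len≤n (a≤n ∷ _) with length as in len≡
... | zero  with [] ← as = ≤-trans (≤-reflexive (identity (tri a)))
    (≤-reflexive (sym (trans (cong (packed n) (+-identityʳ a)) (packed-small n a≤n))))
  where
  identity : ∀ t → t + 0 + 0 ≡ t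
  identity = solve-∀
... | suc l with a ≤? suc l
-- The other rows fit a square of side `suc l`. With the first row inserted, all cells number at
-- most the square of `suc (suc l)`, so the height may be raised to `n`.
... | yes a≤1+l = begin
    tri a + shared a as + stars as                ≡⟨ cong (λ x → tri a + x + stars as) (shared-max as≤a) ⟩
    tri a + sum as + stars as                      ≤⟨ +-monoʳ-≤ (tri a + sum as) (stars-descending (suc l) desc (≤-reflexive len≡) (All.map (λ b≤a → ≤-trans b≤a a≤1+l) as≤a)) ⟩
    tri a + sum as + packed (suc l) (sum as)       ≤⟨ insert-row (suc l) a≤1+l sum≤ ⟩
    packed (suc (suc l)) (a + sum as)              ≤⟨ packed-monoʰ-≤ len≤n (+-mono-≤ (m≤n⇒m≤1+n a≤1+l) (≤-trans sum≤ (*-monoʳ-≤ (suc l) (m≤n⇒m≤1+n a≤1+l)))) ⟩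
    packed n (a + sum as)                          ∎
  where
  open ≤-Reasoning
  sum≤ : sum as ≤ suc l * a
  sum≤ = ≤-trans (sum-≤ as≤a) (≤-reflexive (cong (_* a) len≡))
-- The other rows fit a square of side `a`, and a row of length `a` on top counts the same as a full
-- first column of height `a`.
... | no a≰1+l = begin
    tri a + shared a as + stars as                ≡⟨ cong (λ x → tri a + x + stars as) (shared-max as≤a) ⟩
    tri a + sum as + stars as                      ≤⟨ +-monoʳ-≤ (tri a + sum as) (stars-descending a desc (≤-trans (≤-reflexive len≡) (<⇒≤ l<a)) as≤a) ⟩
    tri a + sum as + packed a (sum as)             ≡⟨ packed-peel a (sum as) ⟨
    packed a (a + sum as)                          ≤⟨ packed-monoʰ-≤ a≤n (≤-trans (+-monoʳ-≤ a sum≤) (*-monoˡ-≤ a l<a)) ⟩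
    packed n (a + sum as)                          ∎
  where
  open ≤-Reasoning
  l<a : suc l < a
  l<a = ≰⇒> a≰1+l
  sum≤ : sum as ≤ suc l * a
  sum≤ = ≤-trans (sum-≤ as≤a) (≤-reflexive (cong (_* a) len≡))
  instance
    a≢0 : NonZero a
    a≢0 = >-nonZero (<-trans z<s l<a)

stars-≤-packed : ∀ n .{{_ : NonZero n}} {as} → length as ≤ n → All (_≤ n) as → stars as ≤ packed n (sum as)
stars-≤-packed n {as} len≤n as≤n = begin
  stars as                 ≡⟨ stars-↭ (sort-↭ as) ⟨
  stars (sort as)          ≤⟨ stars-descending n (Sorted⇒AllPairs (DecTotalOrder.totalOrder ≥-decTotalOrder) (sort-↗ as))
                                (≤-trans (≤-reflexive (↭-length (sort-↭ as))) len≤n) (All-resp-↭ (↭-sym (sort-↭ as)) as≤n) ⟩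
  packed n (sum (sort as)) ≡⟨ cong (packed n) (sum-↭ (sort-↭ as)) ⟩
  packed n (sum as)        ∎
  where open ≤-Reasoning

-- Degree sequences containing a block

shared-++ : ∀ a xs ys → shared a (xs ++ ys) ≡ shared a xs + shared a ys
shared-++ a xs ys = trans (cong sum (map-++ (a ⊓_) xs ys)) (sum-++ (map (a ⊓_) xs) _)

-- As `k` separates the two lists, a row of `ys` lies wholly under each row of `xs`, so each of its
-- cells has `length xs` cells above it.
stars-++ : ∀ {k xs ys} → All (k ≤_) xs → All (_≤ k) ys →
  stars (xs ++ ys) ≡ stars xs + stars ys + length xs * sum ys
stars-++ {ys = ys} [] _ = sym (+-identityʳ (stars ys))
stars-++ {k} {x ∷ xs} {ys} (k≤x ∷ k≤xs) ys≤k
  rewrite shared-++ x xs ys | shared-max (All.map (λ y≤k → ≤-trans y≤k k≤x) ys≤k) | stars-++ k≤xs ys≤k =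
  identity (tri x) (shared x xs) (stars xs) (stars ys) (sum ys) (length xs)
  where
  identity : ∀ t o a b s l → t + (o + s) + (a + b + l * s) ≡ t + o + a + b + (s + l * s)
  identity = solve-∀

-- This is the number of two-edge stars in the complete bipartite graph with parts of sizes `l` and
-- `k`.
block : ℕ → ℕ → ℕ
block l k = l * tri k + k * tri l

shared-map-+ : ∀ k a bs → shared (k + a) (map (k +_) bs) ≡ length bs * k + shared a bs
shared-map-+ k a []       = refl
shared-map-+ k a (b ∷ bs) rewrite shared-map-+ k a bs | sym (+-distribˡ-⊓ k a b) =
  identity k (a ⊓ b) (length bs * k) (shared a bs)
  where
  identity : ∀ k m l o → k + m + (l + o) ≡ k + l + (m + o)
  identity = solve-∀

-- The first `k` cells of the rows form a full block, and each cell of `as` has these `k` cells to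
-- its left.
stars-map-+ : ∀ k as → stars (map (k +_) as) ≡ block (length as) k + k * sum as + stars as
stars-map-+ k []       = identity k
  where
  identity : ∀ k → 0 ≡ k * 0 + k * 0 + 0
  identity = solve-∀
stars-map-+ k (a ∷ as)
  rewrite shared-map-+ k a as | stars-map-+ k as | tri-+ k a =
  identity (tri k) (tri a) k a (length as) (shared a as) (tri (length as)) (sum as) (stars as)
  where
  identity : ∀ tk ta k a l o tl s f →
    tk + ta + k * a + (l * k + o) + (l * tk + k * tl + k * s + f)
    ≡ (1 + l) * tk + k * (l + tl) + k * (a + s) + (ta + o + f)
  identity = solve-∀

-- The excess xs sits k columns to the right of the block, ys sits below it, at
-- depth at least k + d; moving the excess down costs nothing because raising
-- the column height by d gains at most d per cell.
stars-excess : ∀ n .{{_ : NonZero n}} k d {xs ys} → length xs ≡ k + d → k ≤ n → length ys ≤ n →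
  All (_≤ n + d) xs → All (_≤ k) ys →
  stars (map (k +_) xs ++ ys) ≤ block (k + d) k + (k + d) * (sum xs + sum ys) + packed n (sum xs + sum ys)
stars-excess n k d {xs} {ys} len≡ k≤n len≤n xs≤n+d ys≤k = begin
  stars (map (k +_) xs ++ ys)
    ≡⟨ stars-++ (k≤map xs) ys≤k ⟩
  stars (map (k +_) xs) + stars ys + length (map (k +_) xs) * sum ys
    ≡⟨ cong₂ (λ x y → x + stars ys + y * sum ys) (trans (stars-map-+ k xs) (cong (λ l → block l k + k * sum xs + stars xs) len≡)) (trans (length-map (k +_) xs) len≡) ⟩
  block (k + d) k + k * sum xs + stars xs + stars ys + (k + d) * sum ys
    ≤⟨ +-monoˡ-≤ _ (+-mono-≤ (+-monoʳ-≤ (block (k + d) k + k * sum xs) excess) below) ⟩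
  block (k + d) k + k * sum xs + (d * sum xs + packed n (sum xs)) + packed n (sum ys) + (k + d) * sum ys
    ≡⟨ identity (block (k + d) k) k d (sum xs) (sum ys) (packed n (sum xs)) (packed n (sum ys)) ⟩
  block (k + d) k + (k + d) * (sum xs + sum ys) + (packed n (sum xs) + packed n (sum ys))
    ≤⟨ +-monoʳ-≤ (block (k + d) k + (k + d) * (sum xs + sum ys)) (packed-superadditive n (sum xs) (sum ys)) ⟩
  block (k + d) k + (k + d) * (sum xs + sum ys) + packed n (sum xs + sum ys) ∎
  where
  open ≤-Reasoning
  instance
    d+n≢0 : NonZero (d + n)
    d+n≢0 = >-nonZero (m≤n⇒m≤o+n d (>-nonZero⁻¹ n))
  k≤map : ∀ zs → All (k ≤_) (map (k +_) zs)
  k≤map []       = []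
  k≤map (z ∷ zs) = m≤m+n k z ∷ k≤map zs
  excess : stars xs ≤ d * sum xs + packed n (sum xs)
  excess = ≤-trans
    (stars-≤-packed (d + n) (≤-trans (≤-reflexive (trans len≡ (+-comm k d))) (+-monoʳ-≤ d k≤n))
      (All.map (λ x≤ → ≤-trans x≤ (≤-reflexive (+-comm n d))) xs≤n+d))
    (packed-+-≤ n d (sum xs))
  below : stars ys ≤ packed n (sum ys)
  below = stars-≤-packed n len≤n (All.map (λ y≤k → ≤-trans y≤k k≤n) ys≤k)
  identity : ∀ b k d x y p q → b + k * x + (d * x + p) + q + (k + d) * y ≡ b + (k + d) * (x + y) + (p + q)
  identity = solve-∀

-- If `k ≤ r`, the new row is inserted and raises the height to `suc r`. Otherwise the height stays
-- `k`, and the row counts like a full column of `k` cells.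
add-row : ∀ k r {n n′ f} .{{_ : NonZero n}} .{{_ : NonZero n′}} →
  n ≡ r ⊔ k → n′ ≡ suc r ⊔ k → f ≤ r * k → tri k + f + packed n f ≤ packed n′ (k + f)
add-row k r n≡ n′≡ f≤ with k ≤? r
... | yes k≤r with refl ← trans n≡ (m≥n⇒m⊔n≡m k≤r) | refl ← trans n′≡ (m≥n⇒m⊔n≡m (m≤n⇒m≤1+n k≤r)) =
  insert-row r k≤r f≤
... | no k≰r with refl ← trans n≡ (m≤n⇒m⊔n≡n (<⇒≤ (≰⇒> k≰r))) | refl ← trans n′≡ (m≤n⇒m⊔n≡n (≰⇒> k≰r)) =
  ≤-reflexive (sym (packed-peel k _))

-- The lowest row of the block is recounted as the top row of the part below: its `k` cells keep `l`
-- block rows above them, and its share `tri k + g` is absorbed by `add-row`. Each row released adds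
-- `k` cells and one row below, so the cells there never exceed `k` times the rows there.
shrink-block : ∀ k .{{_ : NonZero k}} d l r f n n′ .{{_ : NonZero n}} .{{_ : NonZero n′}} → n ≡ r ⊔ k → n′ ≡ (d + r) ⊔ k → f ≤ r * k →
  block (d + l) k + (d + l) * f + packed n f ≤ block l k + l * (d * k + f) + packed n′ (d * k + f)
shrink-block k zero l r f n n′ refl refl f≤ = ≤-refl
shrink-block k (suc d) l r f n n′ n≡ refl f≤ = begin
  block (suc d + l) k + (suc d + l) * f + packed n f
    ≡⟨ cong (λ x → block x k + x * f + packed n f) (+-suc d l) ⟨
  block (d + suc l) k + (d + suc l) * f + packed n f
    ≤⟨ shrink-block k d (suc l) r f n ((d + r) ⊔ k) n≡ refl f≤ ⟩
  block (suc l) k + suc l * g + packed ((d + r) ⊔ k) g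
    ≡⟨ identity l k (tri k) (tri l) g (packed ((d + r) ⊔ k) g) ⟩
  block l k + l * (k + g) + (tri k + g + packed ((d + r) ⊔ k) g)
    ≤⟨ +-monoʳ-≤ (block l k + l * (k + g)) row ⟩
  block l k + l * (k + g) + packed ((suc d + r) ⊔ k) (k + g)
    ≡⟨ cong (λ x → block l k + l * x + packed ((suc d + r) ⊔ k) x) (+-assoc k (d * k) f) ⟨
  block l k + l * (suc d * k + f) + packed ((suc d + r) ⊔ k) (suc d * k + f) ∎
  where
  open ≤-Reasoning
  g = d * k + f
  instance
    ⊔k≢0 : ∀ {a} → NonZero (a ⊔ k)
    ⊔k≢0 {a} = >-nonZero (≤-trans (>-nonZero⁻¹ k) (m≤n⊔m a k))
  row : tri k + g + packed ((d + r) ⊔ k) g ≤ packed ((suc d + r) ⊔ k) (k + g)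
  row = add-row k (d + r) refl refl (≤-trans (+-monoʳ-≤ (d * k) f≤) (≤-reflexive (sym (*-distribʳ-+ k d r))))
  identity : ∀ l k a b g p → (1 + l) * a + k * (l + b) + (1 + l) * g + p ≡ l * a + k * b + l * (k + g) + (a + g + p)
  identity = solve-∀

-- From biadjacency matrices to degree sequences

bit : Bool → ℕ
bit b = if b then 1 else 0

∣tabulate∣ : ∀ {n} (f : Fin n → Bool) → ∣ Vec.tabulate f ∣ ≡ ∑[ i < n ] bit (f i)
∣tabulate∣ {zero}  f = refl
∣tabulate∣ {suc n} f with f zero
... | true  = cong suc (∣tabulate∣ (f ∘ suc))
... | false = ∣tabulate∣ (f ∘ suc)

∑-mono-≤ : ∀ n {f g : Fin n → ℕ} → (∀ i → f i ≤ g i) → ∑[ i < n ] f i ≤ ∑[ i < n ] g i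
∑-mono-≤ zero    f≤g = z≤n
∑-mono-≤ (suc n) f≤g = +-mono-≤ (f≤g zero) (∑-mono-≤ n (f≤g ∘ suc))

size : ∀ {n} → (Fin n → Bool) → ℕ
size {n} f = ∑[ i < n ] bit (f i)

meet : ∀ {n} → (Fin n → Bool) → (Fin n → Bool) → ℕ
meet {n} f g = ∑[ i < n ] (bit (f i) * bit (g i))

meet-≤ : ∀ {n} (f g : Fin n → Bool) → meet f g ≤ size f ⊓ size g
meet-≤ {n} f g = ⊓-glb (∑-mono-≤ n (λ i → leftBit (f i) (g i))) (∑-mono-≤ n (λ i → rightBit (f i) (g i)))
  where
  leftBit : ∀ a b → bit a * bit b ≤ bit a
  leftBit true  true  = ≤-refl
  leftBit true  false = z≤n
  leftBit false b     = z≤n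
  rightBit : ∀ a b → bit a * bit b ≤ bit b
  rightBit true  b = ≤-reflexive (+-identityʳ (bit b))
  rightBit false b = z≤n

-- A new neighbour of `w` creates one star centred at `w` with each old neighbour. Summed over `w`,
-- these are the common neighbours of the new vertex with each of the others.
∑-tri-columns : ∀ {r s} (A : Fin (suc r) → Fin s → Bool) →
  ∑[ w < s ] tri (∑[ u < suc r ] bit (A u w))
  ≡ ∑[ u < r ] meet (A zero) (A (suc u)) + ∑[ w < s ] tri (∑[ u < r ] bit (A (suc u) w))
∑-tri-columns {r} {s} A = begin
  ∑[ w < s ] tri (bit (A zero w) + d w)               ≡⟨ sum-cong-≗ (λ w → tri-bit (A zero w) (d w)) ⟩
  ∑[ w < s ] (bit (A zero w) * d w + tri (d w))       ≡⟨ ∑-distrib-+ (λ w → bit (A zero w) * d w) _ ⟩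
  ∑[ w < s ] (bit (A zero w) * d w) + ∑[ w < s ] tri (d w)
    ≡⟨ cong (_+ ∑[ w < s ] tri (d w)) (trans
         (sum-cong-≗ (λ w → *-distribˡ-sum (bit (A zero w)) (λ u → bit (A (suc u) w))))
         (∑-comm (λ w u → bit (A zero w) * bit (A (suc u) w)))) ⟩
  ∑[ u < r ] meet (A zero) (A (suc u)) + ∑[ w < s ] tri (d w) ∎
  where
  open ≡-Reasoning
  d : Fin s → ℕ
  d w = ∑[ u < r ] bit (A (suc u) w)
  tri-bit : ∀ b n → tri (bit b + n) ≡ bit b * n + tri n
  tri-bit true  n = cong (_+ tri n) (sym (+-identityʳ n))
  tri-bit false n = refl

sum-tabulate : ∀ {n} (f : Fin n → ℕ) → sum (tabulate f) ≡ ∑[ i < n ] f i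
sum-tabulate {zero}  f = refl
sum-tabulate {suc n} f = cong (f zero +_) (sum-tabulate (f ∘ suc))

-- Stars centred in W are pairs of vertices of U with a common neighbour, and two vertices have at
-- most the smaller of their degrees in common.
stars-matrix : ∀ {r s} (A : Fin r → Fin s → Bool) →
  ∑[ u < r ] tri (size (A u)) + ∑[ w < s ] tri (∑[ u < r ] bit (A u w)) ≤ stars (tabulate (size ∘ A))
stars-matrix {zero}  {s} A = ≤-reflexive (∑-zero s)
  where
  ∑-zero : ∀ s → ∑[ w < s ] 0 ≡ 0
  ∑-zero zero    = refl
  ∑-zero (suc s) = ∑-zero s
stars-matrix {suc r} {s} A = begin
  tri (size (A zero)) + R + ∑[ w < s ] tri (∑[ u < suc r ] bit (A u w))
    ≡⟨ cong (tri (size (A zero)) + R +_) (∑-tri-columns A) ⟩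
  tri (size (A zero)) + R + (∑[ u < r ] meet (A zero) (A (suc u)) + C)
    ≡⟨ identity (tri (size (A zero))) R (∑[ u < r ] meet (A zero) (A (suc u))) C ⟩
  tri (size (A zero)) + ∑[ u < r ] meet (A zero) (A (suc u)) + (R + C)
    ≤⟨ +-mono-≤ (+-monoʳ-≤ (tri (size (A zero))) meets) (stars-matrix (A ∘ suc)) ⟩
  stars (tabulate (size ∘ A)) ∎
  where
  open ≤-Reasoning
  R = ∑[ u < r ] tri (size (A (suc u)))
  C = ∑[ w < s ] tri (∑[ u < r ] bit (A (suc u) w))
  meets : ∑[ u < r ] meet (A zero) (A (suc u)) ≤ shared (size (A zero)) (tabulate (size ∘ A ∘ suc))
  meets = ≤-trans (∑-mono-≤ r (λ u → meet-≤ (A zero) (A (suc u))))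
    (≤-reflexive (trans (sym (sum-tabulate (λ u → size (A zero) ⊓ size (A (suc u))))) (cong sum (sym (map-tabulate (size ∘ A ∘ suc) (size (A zero) ⊓_))))))
  identity : ∀ a b c d → a + b + (c + d) ≡ a + c + (b + d)
  identity = solve-∀

module _ {r s : ℕ} (G : BipartiteGraph r s) where

  degrees : List ℕ
  degrees = tabulate (degU G)

  N-S₂-tri : N-S₂ G ≡ ∑[ u < r ] tri (size (adj G u)) + ∑[ w < s ] tri (∑[ u < r ] bit (adj G u w))
  N-S₂-tri = cong₂ _+_
    (sum-cong-≗ (λ u → trans (tri≡C2 (degU G u)) (cong tri (∣tabulate∣ (adj G u)))))
    (sum-cong-≗ (λ w → trans (tri≡C2 (degW G w)) (cong tri (∣tabulate∣ (λ u → adj G u w)))))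

  N-S₂≤stars : N-S₂ G ≤ stars degrees
  N-S₂≤stars = begin
    N-S₂ G                            ≡⟨ N-S₂-tri ⟩
    _                                 ≤⟨ stars-matrix (adj G) ⟩
    stars (tabulate (size ∘ adj G))   ≡⟨ cong stars (tabulate-cong (λ u → ∣tabulate∣ (adj G u))) ⟨
    stars degrees                     ∎
    where
    open ≤-Reasoning

  length-edges : length (edges G) ≡ sum degrees
  length-edges = trans (rows (allFin r)) (cong sum (map-tabulate id (degU G)))
    where
    open ≡-Reasoning
    edge? = λ e → T? (uncurry (adj G) e)
    row : ∀ {n} (g : Fin n → Fin r × Fin s) →
      length (filter edge? (tabulate g)) ≡ ∑[ i < n ] bit (uncurry (adj G) (g i))
    row {zero}  g = refl
    row {suc n} g with uncurry (adj G) (g zero)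
    ... | true  = cong suc (row (g ∘ suc))
    ... | false = row (g ∘ suc)
    rows : ∀ us → length (filter edge? (cartesianProduct us (allFin s))) ≡ sum (map (degU G) us)
    rows []       = refl
    rows (u ∷ us) = begin
      length (filter edge? (map (u ,_) (allFin s) ++ cartesianProduct us (allFin s)))
        ≡⟨ cong length (filter-++ edge? (map (u ,_) (allFin s)) _) ⟩
      length (filter edge? (map (u ,_) (allFin s)) ++ filter edge? (cartesianProduct us (allFin s)))
        ≡⟨ length-++ (filter edge? (map (u ,_) (allFin s))) ⟩
      length (filter edge? (map (u ,_) (allFin s))) + length (filter edge? (cartesianProduct us (allFin s)))
        ≡⟨ cong₂ _+_ (trans (cong (length ∘ filter edge?) (map-tabulate id (u ,_)))
                       (trans (row (u ,_)) (sym (∣tabulate∣ (adj G u))))) (rows us) ⟩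
      degU G u + sum (map (degU G) us) ∎

  degrees-≤ : All (_≤ s) degrees
  degrees-≤ = tabulate⁺ (λ u → ∣p∣≤n (Vec.tabulate (adj G u)))

  -- The set `I` enters the upper bound through this count: each of its vertices has degree at least
  -- the minimum over `I`.
  ∣I∣≤large-degrees : ∀ {k} I → k ≤ δU G I → ∣ I ∣ ≤ length (filter (k ≤?_) degrees)
  ∣I∣≤large-degrees {k} I k≤δ = count I (degU G) (λ u u∈I → ≤-trans k≤δ (All.lookup
      (min≤xs s (map (degU G) (filter (_∈? I) (allFin r))))
      (∈-map⁺ (degU G) (∈-filter⁺ (_∈? I) (∈-allFin u) u∈I))))
    where
    count : ∀ {n} (J : Subset n) (f : Fin n → ℕ) → (∀ u → u ∈ J → k ≤ f u) →
      ∣ J ∣ ≤ length (filter (k ≤?_) (tabulate f))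
    count []          f k≤f = z≤n
    count (true ∷ J)  f k≤f rewrite filter-accept (k ≤?_) {xs = tabulate (f ∘ suc)} (k≤f zero Vec.here) =
      s≤s (count J (f ∘ suc) (λ u u∈J → k≤f (suc u) (Vec.there u∈J)))
    count (false ∷ J) f k≤f with k ≤? f zero
    ... | yes p rewrite filter-accept (k ≤?_) {xs = tabulate (f ∘ suc)} p =
      m≤n⇒m≤1+n (count J (f ∘ suc) (λ u u∈J → k≤f (suc u) (Vec.there u∈J)))
    ... | no p rewrite filter-reject (k ≤?_) {xs = tabulate (f ∘ suc)} p =
      count J (f ∘ suc) (λ u u∈J → k≤f (suc u) (Vec.there u∈J))

-- The upper bound relative to a block

filter-complement-↭ : ∀ {a p} {A : Set a} {P : Pred A p} (P? : Decidable P) xs →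
  xs ↭ filter P? xs ++ filter (¬? ∘ P?) xs
filter-complement-↭ P? []       = Perm.refl
filter-complement-↭ P? (x ∷ xs) with P? x
... | yes _ = prep x (filter-complement-↭ P? xs)
... | no  _ = ↭-trans (prep x (filter-complement-↭ P? xs)) (↭-sym (shift x (filter P? xs) _))

-- The height `(r ∸ l) ⊔ k` treats two extremal shapes at once: it is the column height `r ∸ l` of
-- `B₁` if `k + l ≤ r`, and the row length `k` of `B₂` otherwise.
stars-≤-block : ∀ {k l r s e as} n .{{_ : NonZero k}} .{{_ : NonZero n}} →
  n ≡ (r ∸ l) ⊔ k → length as ≡ r → All (_≤ s) as → s ≤ r → k ≤ l → l ≤ length (filter (k ≤?_) as) →
  sum as ≡ k * l + e → k * l + e ≤ r * k →
  stars as ≤ block l k + l * e + packed n e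
stars-≤-block {k} {l} {r} {s} {e} {as} n n≡ len≡r as≤s s≤r k≤l l≤large sum≡ sum≤ = begin
  stars as
    ≡⟨ stars-↭ as↭ ⟩
  stars (map (k +_) xs ++ ys)
    ≤⟨ stars-excess n* k d len-xs (m≤n⊔m r′ k) (m≤m⊔n r′ k) xs≤ ys≤k ⟩
  block (k + d) k + (k + d) * f + packed n* f
    ≡⟨ cong (λ x → block x k + x * f + packed n* f) k+d≡ ⟩
  block (d₀ + l) k + (d₀ + l) * f + packed n* f
    ≤⟨ shrink-block k d₀ l r′ f n* n refl (trans n≡ (cong (_⊔ k) r∸l≡)) f≤ ⟩
  block l k + l * (d₀ * k + f) + packed n (d₀ * k + f)
    ≡⟨ cong (λ x → block l k + l * x + packed n x) e≡ ⟨
  block l k + l * e + packed n e ∎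
  where
  open ≤-Reasoning
  large = filter (k ≤?_) as
  xs = map (_∸ k) large
  ys = filter (¬? ∘ (k ≤?_)) as
  -- The large rows exceed `k` in number by `d`, and `d₀` of them have to be released to leave a
  -- block of `l` rows.
  d = length large ∸ k
  d₀ = length large ∸ l
  f = sum xs + sum ys
  r′ = length ys
  n* = r′ ⊔ k
  instance
    n*≢0 : NonZero n*
    n*≢0 = >-nonZero (≤-trans (>-nonZero⁻¹ k) (m≤n⊔m r′ k))
  as↭ : as ↭ map (k +_) xs ++ ys
  as↭ = subst (λ zs → as ↭ zs ++ ys)
    (sym (trans (sym (map-∘ large)) (map-id-local (All.map m+[n∸m]≡n (all-filter (k ≤?_) as)))))
    (filter-complement-↭ (k ≤?_) as)
  k+d≡ : k + d ≡ d₀ + l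
  k+d≡ = trans (m+[n∸m]≡n (≤-trans k≤l l≤large)) (sym (m∸n+n≡m l≤large))
  len-large : length large ≡ k + d
  len-large = sym (m+[n∸m]≡n (≤-trans k≤l l≤large))
  len-xs : length xs ≡ k + d
  len-xs = trans (length-map (_∸ k) large) len-large
  ys≤k : All (_≤ k) ys
  ys≤k = All.map (λ k≰y → <⇒≤ (≰⇒> k≰y)) (all-filter (¬? ∘ (k ≤?_)) as)
  r≡ : r ≡ k + d + r′
  r≡ = trans (sym len≡r) (trans (↭-length (filter-complement-↭ (k ≤?_) as))
    (trans (length-++ large) (cong (_+ r′) len-large)))
  r∸l≡ : r ∸ l ≡ d₀ + r′
  r∸l≡ = trans (cong (_∸ l) (trans r≡ (trans (cong (_+ r′) k+d≡) (assoc d₀ l r′)))) (m+n∸m≡n l (d₀ + r′))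
    where
    assoc : ∀ d l r → d + l + r ≡ l + (d + r)
    assoc = solve-∀
  -- Degrees are at most `s`, hence at most `k + d + r′`, so an excess over `k` is at most `d + r′`.
  xs≤ : All (_≤ n* + d) xs
  xs≤ = map-∸ large (filter⁺ (k ≤?_) as≤s)
    where
    bound : ∀ {x} → x ≤ s → x ∸ k ≤ n* + d
    bound {x} x≤s = ≤-trans (m≤n+o⇒m∸n≤o x k (≤-trans x≤s (≤-trans s≤r (≤-reflexive (trans r≡ (+-assoc k d r′))))))
      (≤-trans (≤-reflexive (+-comm d r′)) (+-monoˡ-≤ d (m≤m⊔n r′ k)))
    map-∸ : ∀ zs → All (_≤ s) zs → All (_≤ n* + d) (map (_∸ k) zs)
    map-∸ []       []        = []
    map-∸ (_ ∷ zs) (z≤ ∷ zs≤) = bound z≤ ∷ map-∸ zs zs≤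
  sum-map-+ : ∀ zs → sum (map (k +_) zs) ≡ length zs * k + sum zs
  sum-map-+ []       = refl
  sum-map-+ (z ∷ zs) = trans (cong (k + z +_) (sum-map-+ zs)) (identity k z (length zs * k) (sum zs))
    where
    identity : ∀ k z l s → k + z + (l + s) ≡ k + l + (z + s)
    identity = solve-∀
  sum-as : sum as ≡ (k + d) * k + f
  sum-as = trans (sum-↭ as↭) (trans (sum-++ (map (k +_) xs) ys)
    (trans (cong (_+ sum ys) (trans (sum-map-+ xs) (cong (λ x → x * k + sum xs) len-xs))) (+-assoc ((k + d) * k) _ _)))
  e≡ : e ≡ d₀ * k + f
  e≡ = +-cancelˡ-≡ (k * l) _ _ (trans (sym sum≡) (trans sum-as (trans (cong (λ x → x * k + f) k+d≡) (identity d₀ l k f))))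
    where
    identity : ∀ d l k f → (d + l) * k + f ≡ k * l + (d * k + f)
    identity = solve-∀
  -- Of at most `r * k` cells the block of all large rows takes `(k + d) * k`, and `r′` rows remain.
  f≤ : f ≤ r′ * k
  f≤ = +-cancelˡ-≤ ((k + d) * k) _ _ (≤-trans (≤-reflexive (trans (sym sum-as) sum≡))
    (≤-trans sum≤ (≤-reflexive (trans (cong (_* k) r≡) (*-distribʳ-+ k (k + d) r′)))))

-- Star counts of the extremal graphs

-- Indexing by numbers instead of `Fin` lets a range be split anywhere without converting indices.
Σ< : ℕ → (ℕ → ℕ) → ℕ
Σ< zero    f = 0
Σ< (suc n) f = f 0 + Σ< n (f ∘ suc)

∑≡Σ< : ∀ n f → ∑[ i < n ] f (toℕ i) ≡ Σ< n f
∑≡Σ< zero    f = refl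
∑≡Σ< (suc n) f = cong (f 0 +_) (∑≡Σ< n (f ∘ suc))

Σ<-≥ : ∀ a b f {x y} → (∀ {i} → i < a → x ≤ f i) → y ≤ Σ< b (f ∘ (a +_)) → a * x + y ≤ Σ< (a + b) f
Σ<-≥ zero    b f     x≤f y≤ = y≤
Σ<-≥ (suc a) b f {x} x≤f y≤ = ≤-trans (≤-reflexive (+-assoc x (a * x) _))
  (+-mono-≤ (x≤f z<s) (Σ<-≥ a b (f ∘ suc) (x≤f ∘ s<s) y≤))

Σ<-≥-const : ∀ n f {x} → (∀ {i} → i < n → x ≤ f i) → n * x ≤ Σ< n f
Σ<-≥-const n f {x} x≤f =
  subst₂ _≤_ (+-identityʳ (n * x)) (cong (λ m → Σ< m f) (+-identityʳ n)) (Σ<-≥ n 0 f x≤f z≤n)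

Σ<-bit-≥ : ∀ {c n} b → c ≤ n → (∀ {j} → j < c → b j ≡ true) → c ≤ Σ< n (bit ∘ b)
Σ<-bit-≥ {c} {n} b c≤n b≡ = subst₂ _≤_
  (trans (+-identityʳ (c * 1)) (*-identityʳ c)) (cong (λ m → Σ< m (bit ∘ b)) (m+[n∸m]≡n c≤n))
  (Σ<-≥ c (n ∸ c) (bit ∘ b) {1} {0} (λ j<c → ≤-reflexive (sym (cong bit (b≡ j<c)))) z≤n)

∨ˡ : ∀ {a b} → a ≡ true → a ∨ b ≡ true
∨ˡ refl = refl

∨ʳ : ∀ a {b} → b ≡ true → a ∨ b ≡ true
∨ʳ true  _ = refl
∨ʳ false p = p

<ᵇ-true : ∀ {m n} → m < n → (suc m ≤ᵇ n) ≡ true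
<ᵇ-true m<n = Equivalence.to T-≡ (≤⇒≤ᵇ m<n)

≤ᵇ-true : ∀ {m n} → m ≤ n → (m ≤ᵇ n) ≡ true
≤ᵇ-true m≤n = Equivalence.to T-≡ (≤⇒≤ᵇ m≤n)

≡ᵇ-true : ∀ {m n} → m ≡ n → (m ≡ᵇ n) ≡ true
≡ᵇ-true m≡n = Equivalence.to T-≡ (≡⇒≡ᵇ _ _ m≡n)

≡ᵇ-false : ∀ {m n} → m < n → (m ≡ᵇ n) ≡ false
≡ᵇ-false z<s       = refl
≡ᵇ-false (s<s m<n@(s≤s _)) = ≡ᵇ-false m<n

module _ (r s : ℕ) (E : ℕ → ℕ → Bool) where

  triRow triColumn : ℕ → ℕ
  triRow    i = tri (Σ< s (λ j → bit (E (suc i) (suc j))))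
  triColumn j = tri (Σ< r (λ i → bit (E (suc i) (suc j))))

  N-S₂-fromIndices : N-S₂ (fromIndices r s E) ≡ Σ< r triRow + Σ< s triColumn
  N-S₂-fromIndices = trans (N-S₂-tri (fromIndices r s E)) (cong₂ _+_
    (trans (sum-cong-≗ {r} (λ u → cong tri (∑≡Σ< s (λ j → bit (E (suc (toℕ u)) (suc j)))))) (∑≡Σ< r triRow))
    (trans (sum-cong-≗ {s} (λ w → cong tri (∑≡Σ< r (λ i → bit (E (suc i) (suc (toℕ w))))))) (∑≡Σ< s triColumn)))

  N-S₂-≥ : ∀ {x y} → x ≤ Σ< r triRow → y ≤ Σ< s triColumn → x + y ≤ N-S₂ (fromIndices r s E)
  N-S₂-≥ x≤ y≤ = ≤-trans (+-mono-≤ x≤ y≤) (≤-reflexive (sym N-S₂-fromIndices))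

  triRow-≥ : ∀ {i c} → c ≤ s → (∀ {j} → j < c → E (suc i) (suc j) ≡ true) → tri c ≤ triRow i
  triRow-≥ {i} c≤s full = tri-mono-≤ (Σ<-bit-≥ (λ j → E (suc i) (suc j)) c≤s full)

  triColumn-≥ : ∀ {j c} → c ≤ r → (∀ {i} → i < c → E (suc i) (suc j) ≡ true) → tri c ≤ triColumn j
  triColumn-≥ {j} c≤r full = tri-mono-≤ (Σ<-bit-≥ (λ i → E (suc i) (suc j)) c≤r full)

-- Edges known to be present bound the degrees from below, which bounds the star count. The left
-- side is the block, `l` for each cell outside it, and the formula of `packed-blocks` for columns
-- of height `n`. An empty block gives `B`, a general one `B₁`.
columns-≥ : ∀ {r s} E l n k p q → l + n ≡ r → q ≤ n → k ≤ s → p < k ⊎ (p ≡ k × q ≡ 0) →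
  (∀ {i j} → i < r → j < p → E (suc i) (suc j) ≡ true) →
  (∀ {i} → p < k → i < l + q → E (suc i) (suc p) ≡ true) →
  (∀ {i j} → i < l → p < j → j < k → E (suc i) (suc j) ≡ true) →
  block l k + l * (p * n + q) + (p * tri n + n * tri p + tri q + p * q) ≤ N-S₂ (fromIndices r s E)
-- Here `r′` counts the rows bounded below by `p`, `c` the columns with only the block's `l` cells
-- guaranteed, and `s′` the columns from `k` on, bounded below by 0.
columns-≥ E l n k p q refl q≤n k≤s (inj₁ p<k) full part blk
  with r′ , refl ← m≤n⇒∃[o]m+o≡n q≤n
  with c , refl ← m≤n⇒∃[o]m+o≡n p<k
  with s′ , refl ← m≤n⇒∃[o]m+o≡n k≤s
  = ≤-trans (≤-reflexive equation) (N-S₂-≥ r s E rows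
      (subst (λ x → p * tri r + (tri (l + q) + (c * tri l + 0)) ≤ Σ< x (triColumn r s E)) (s≡ p c s′) columns))
  where
  r = l + (q + r′)
  s = suc p + c + s′
  row-l : ∀ {i j} → i < l → j < suc p + c → E (suc i) (suc j) ≡ true
  row-l {i} {j} i<l j<k with <-cmp j p
  ... | tri< j<p _ _  = full (≤-trans i<l (m≤m+n l _)) j<p
  ... | tri≈ _ refl _ = part p<k (≤-trans i<l (m≤m+n l _))
  ... | tri> _ _ p<j  = blk i<l p<j j<k
  row-q : ∀ {i j} → i < q → j < suc p → E (suc (l + i)) (suc j) ≡ true
  row-q {i} {j} i<q j<1+p with m<1+n⇒m<n∨m≡n j<1+p
  ... | inj₁ j<p  = full (+-monoʳ-< l (≤-trans i<q q≤n)) j<p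
  ... | inj₂ refl = part p<k (+-monoʳ-< l i<q)
  col-p : ∀ {i j} → j ≡ p → i < l + q → E (suc i) (suc j) ≡ true
  col-p refl = part p<k
  col-c : ∀ {j} → j < c → p + suc j < suc p + c
  col-c j<c = ≤-trans (s≤s (≤-trans (≤-reflexive (+-suc p _)) (s≤s ≤-refl))) (s≤s (≤-trans (≤-reflexive (sym (+-suc p _))) (+-monoʳ-≤ p j<c)))
  rows : l * tri (suc p + c) + (q * tri (suc p) + r′ * tri p) ≤ Σ< r (triRow r s E)
  rows = Σ<-≥ l (q + r′) (triRow r s E) (λ i<l → triRow-≥ r s E k≤s (row-l i<l))
    (Σ<-≥ q r′ _ (λ i<q → triRow-≥ r s E (≤-trans p<k k≤s) (row-q i<q))
      (Σ<-≥-const r′ _ (λ i<r′ → triRow-≥ r s E (≤-trans (<⇒≤ p<k) k≤s) (full (+-monoʳ-< l (+-monoʳ-< q i<r′))))))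
  columns : p * tri r + (tri (l + q) + (c * tri l + 0)) ≤ Σ< (p + suc (c + s′)) (triColumn r s E)
  columns = Σ<-≥ p (suc (c + s′)) (triColumn r s E) (λ j<p → triColumn-≥ r s E ≤-refl (λ i<r → full i<r j<p))
    (+-mono-≤ (triColumn-≥ r s E (+-monoʳ-≤ l q≤n) (col-p (+-identityʳ p)))
      (Σ<-≥ c s′ _ (λ j<c → triColumn-≥ r s E (m≤m+n l _) (λ i<l → blk i<l (m<m+n p z<s) (col-c j<c))) z≤n))
  s≡ : ∀ p c t → p + (1 + (c + t)) ≡ 1 + p + c + t
  s≡ = solve-∀
  equation : block l (suc p + c) + l * (p * (q + r′) + q) + (p * tri (q + r′) + (q + r′) * tri p + tri q + p * q)
    ≡ l * tri (suc p + c) + (q * tri (suc p) + r′ * tri p) + (p * tri (l + (q + r′)) + (tri (l + q) + (c * tri l + 0)))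
  equation rewrite tri-+ l (q + r′) | tri-+ l q =
    identity l q r′ p c (tri (suc p + c)) (tri l) (tri (q + r′)) (tri p) (tri q)
    where
    identity : ∀ l q r p c K L N P Q →
      l * K + (1 + p + c) * L + l * (p * (q + r) + q) + (p * N + (q + r) * P + Q + p * q)
      ≡ l * K + (q * (p + P) + r * P) + (p * (L + N + l * (q + r)) + (L + Q + l * q + (c * L + 0)))
    identity = solve-∀
columns-≥ E l n k p q refl q≤n k≤s (inj₂ (refl , refl)) full part blk
  with s′ , refl ← m≤n⇒∃[o]m+o≡n k≤s
  = ≤-trans (≤-reflexive equation) (N-S₂-≥ r s E
      (Σ<-≥-const r (triRow r s E) (λ i<r → triRow-≥ r s E k≤s (full i<r)))
      (Σ<-≥ k s′ (triColumn r s E) (λ j<k → triColumn-≥ r s E ≤-refl (λ i<r → full i<r j<k)) z≤n))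
  where
  r = l + n
  s = k + s′
  equation : block l k + l * (k * n + 0) + (k * tri n + n * tri k + 0 + k * 0) ≡ r * tri k + (k * tri r + 0)
  equation rewrite tri-+ l n = identity l n k (tri k) (tri l) (tri n)
    where
    identity : ∀ l n k K L N → l * K + k * L + l * (k * n + 0) + (k * N + n * K + 0 + k * 0)
      ≡ (l + n) * K + (k * (L + N + l * n) + 0)
    identity = solve-∀

-- Outside the block, rows of length `k` are filled instead of columns of height `k`. Transposition
-- keeps the star count, so the formula of `packed-blocks` still applies.
rows-≥ : ∀ {r s} E l k p q → q ≤ k → k ≤ s → l + p < r ⊎ (l + p ≡ r × q ≡ 0) →
  (∀ {i j} → i < l + p → j < k → E (suc i) (suc j) ≡ true) →
  (∀ {i j} → l + p < r → i ≡ l + p → j < q → E (suc i) (suc j) ≡ true) →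
  block l k + l * (p * k + q) + (p * tri k + k * tri p + tri q + p * q) ≤ N-S₂ (fromIndices r s E)
rows-≥ E l k p q q≤k k≤s (inj₁ l+p<r) full part
  with r′ , refl ← m≤n⇒∃[o]m+o≡n l+p<r
  with k′ , refl ← m≤n⇒∃[o]m+o≡n q≤k
  with s′ , refl ← m≤n⇒∃[o]m+o≡n k≤s
  = ≤-trans (≤-reflexive equation) (N-S₂-≥ r s E
      (subst (λ x → (l + p) * tri k + (tri q + 0) ≤ Σ< x (triRow r s E)) (+-suc (l + p) r′) rows)
      (subst (λ x → q * tri (suc (l + p)) + (k′ * tri (l + p) + 0) ≤ Σ< x (triColumn r s E)) (sym (+-assoc q k′ s′)) columns))
  where
  r = suc (l + p) + r′
  s = q + k′ + s′
  rows : (l + p) * tri k + (tri q + 0) ≤ Σ< (l + p + suc r′) (triRow r s E)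
  rows = Σ<-≥ (l + p) (suc r′) (triRow r s E) (λ i< → triRow-≥ r s E k≤s (full i<))
    (+-mono-≤ (triRow-≥ r s E (≤-trans q≤k k≤s) (part l+p<r (+-identityʳ (l + p)))) z≤n)
  column-q : ∀ {i j} → j < q → i < suc (l + p) → E (suc i) (suc j) ≡ true
  column-q j<q i< with m<1+n⇒m<n∨m≡n i<
  ... | inj₁ i<l+p = full i<l+p (≤-trans j<q q≤k)
  ... | inj₂ i≡l+p = part l+p<r i≡l+p j<q
  columns : q * tri (suc (l + p)) + (k′ * tri (l + p) + 0) ≤ Σ< (q + (k′ + s′)) (triColumn r s E)
  columns = Σ<-≥ q (k′ + s′) (triColumn r s E) (λ j<q → triColumn-≥ r s E (m≤m+n (suc (l + p)) r′) (column-q j<q))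
    (Σ<-≥ k′ s′ _ (λ j<k′ → triColumn-≥ r s E (<⇒≤ l+p<r) (λ i< → full i< (+-monoʳ-< q j<k′))) z≤n)
  equation : block l k + l * (p * k + q) + (p * tri k + k * tri p + tri q + p * q)
    ≡ (l + p) * tri k + (tri q + 0) + (q * tri (suc (l + p)) + (k′ * tri (l + p) + 0))
  equation rewrite tri-+ l p = identity l p q k′ (tri k) (tri l) (tri p) (tri q)
    where
    identity : ∀ l p q k K L P Q →
      l * K + (q + k) * L + l * (p * (q + k) + q) + (p * K + (q + k) * P + Q + p * q)
      ≡ (l + p) * K + (Q + 0) + (q * (l + p + (L + P + l * p)) + (k * (L + P + l * p) + 0))
    identity = solve-∀
rows-≥ E l k p q q≤k k≤s (inj₂ (refl , refl)) full part
  with s′ , refl ← m≤n⇒∃[o]m+o≡n k≤s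
  = ≤-trans (≤-reflexive equation) (N-S₂-≥ (l + p) (k + s′) E
      (Σ<-≥-const (l + p) (triRow (l + p) (k + s′) E) (λ i< → triRow-≥ (l + p) (k + s′) E k≤s (full i<)))
      (Σ<-≥ k s′ (triColumn (l + p) (k + s′) E) (λ j<k → triColumn-≥ (l + p) (k + s′) E ≤-refl (λ i< → full i< j<k)) z≤n))
  where
  equation : block l k + l * (p * k + 0) + (p * tri k + k * tri p + 0 + p * 0) ≡ (l + p) * tri k + (k * tri (l + p) + 0)
  equation rewrite tri-+ l p = identity l p k (tri k) (tri l) (tri p)
    where
    identity : ∀ l p k K L P → l * K + k * L + l * (p * k + 0) + (p * K + k * P + 0 + p * 0)
      ≡ (l + p) * K + (k * (L + P + l * p) + 0)
    identity = solve-∀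

-- This separates the generic case from the full rectangle, where no partial line remains.
quotient-bound : ∀ m n c .{{_ : NonZero n}} → m ≤ c * n → m / n < c ⊎ (m / n ≡ c × m % n ≡ 0)
quotient-bound m n c m≤c*n with m / n <? c
... | yes p<c = inj₁ p<c
... | no  p≮c = inj₂ (p≡c , n≤0⇒n≡0 (+-cancelˡ-≤ (c * n) _ _ (begin
    c * n + m % n      ≡⟨ cong (λ x → x * n + m % n) p≡c ⟨
    m / n * n + m % n  ≡⟨ m≡[m/n]*n+m%n m n ⟨
    m                  ≤⟨ m≤c*n ⟩
    c * n              ≡⟨ +-identityʳ (c * n) ⟨
    c * n + 0          ∎)))
  where
  open ≤-Reasoning
  p≡c : m / n ≡ c
  p≡c = ≤-antisym (*-cancelʳ-≤ (m / n) c n (≤-trans (m/n*n≤m m n) m≤c*n)) (≮⇒≥ p≮c)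

packed-quotient : ∀ n .{{_ : NonZero n}} m →
  packed n m ≡ m / n * tri n + n * tri (m / n) + tri (m % n) + m / n * (m % n)
packed-quotient n m = trans (cong (packed n) (m≡[m/n]*n+m%n m n)) (packed-blocks n (m / n) (<⇒≤ (m%n<n m n)))

∧-true : ∀ {a b} → a ≡ true → b ≡ true → a ∧ b ≡ true
∧-true refl refl = refl

packed≤B : ∀ r s m .{{_ : NonZero r}} → m ≤ s * r → packed r m ≤ N-S₂ (B r s m)
packed≤B r s m m≤sr = ≤-trans (≤-reflexive value)
  -- `B` has an empty block: no rows, and all `s` columns available for packing.
  (columns-≥ E 0 r s p q refl (<⇒≤ (m%n<n m r)) ≤-refl (quotient-bound m r s m≤sr)
    (λ i<r j<p → ∨ˡ (∧-true (<ᵇ-true i<r) (<ᵇ-true j<p)))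
    (λ {i} p<s i<q → ∨ʳ ((suc i ∈[ 1 , r ]) ∧ (suc p ∈[ 1 , p ])) (∧-true (<ᵇ-true i<q) (≡ᵇ-true (+-comm 1 p))))
    (λ ()))
  where
  p = m / r
  q = m % r
  E : ℕ → ℕ → Bool
  E i j = (i ∈[ 1 , r ] ∧ j ∈[ 1 , p ]) ∨ (i ∈[ 1 , q ] ∧ (j ≡ᵇ p + 1))
  value : packed r m ≡ block 0 s + 0 + (p * tri r + r * tri p + tri q + p * q)
  value = trans (packed-quotient r m) (cong (_+ (p * tri r + r * tri p + tri q + p * q)) (sym (trans (+-identityʳ (s * 0)) (*-zeroʳ s))))

block+packed≤B₁ : ∀ r s m ℓ k (ℓ<r : ℓ < r) .{{_ : NonZero (r ∸ ℓ)}} → k ≤ s → m ∸ k * ℓ ≤ k * (r ∸ ℓ) →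
  block ℓ k + ℓ * (m ∸ k * ℓ) + packed (r ∸ ℓ) (m ∸ k * ℓ) ≤ N-S₂ (B₁ r s m ℓ k ℓ<r)
block+packed≤B₁ r s m ℓ k ℓ<r k≤s e≤ = ≤-trans (≤-reflexive value)
  (columns-≥ E ℓ n k p q (m+[n∸m]≡n (<⇒≤ ℓ<r)) (<⇒≤ (m%n<n e n)) k≤s (quotient-bound e n k e≤)
    (λ i<r j<p → ∨ˡ (∧-true (<ᵇ-true i<r) (<ᵇ-true j<p)))
    (λ {i} p<k i<ℓ+q → ∨ʳ ((suc i ∈[ 1 , r ]) ∧ (suc p ∈[ 1 , p ]))
      (∨ˡ (∧-true (cong not (≡ᵇ-false p<k)) (∧-true (<ᵇ-true i<ℓ+q) (≡ᵇ-true (+-comm 1 p))))))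
    -- As `j` counts from 0, the condition `p < j` says that `suc j` is at least `p + 2`.
    (λ {i} {j} i<ℓ p<j j<k → ∨ʳ ((suc i ∈[ 1 , r ]) ∧ (suc j ∈[ 1 , p ]))
      (∨ʳ (not (p ≡ᵇ k) ∧ (suc i ∈[ 1 , ℓ + q ]) ∧ (suc j ≡ᵇ p + 1))
        (∧-true (<ᵇ-true i<ℓ) (∧-true (≤ᵇ-true (≤-trans (≤-reflexive (+-comm p 2)) (s≤s p<j))) (<ᵇ-true j<k))))))
  where
  n = r ∸ ℓ
  e = m ∸ k * ℓ
  p = e / n
  q = e % n
  E : ℕ → ℕ → Bool
  E i j = (i ∈[ 1 , r ] ∧ j ∈[ 1 , p ])
        ∨ (not (p ≡ᵇ k) ∧ i ∈[ 1 , ℓ + q ] ∧ (j ≡ᵇ p + 1))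
        ∨ (i ∈[ 1 , ℓ ] ∧ j ∈[ p + 2 , k ])
  value : block ℓ k + ℓ * e + packed n e ≡ block ℓ k + ℓ * (p * n + q) + (p * tri n + n * tri p + tri q + p * q)
  value = cong₂ (λ x y → block ℓ k + ℓ * x + y) (m≡[m/n]*n+m%n e n) (packed-quotient n e)

block+packed≤B₂ : ∀ r s m ℓ k .{{_ : NonZero k}} → ℓ ≤ r → k ≤ s → m ∸ k * ℓ ≤ (r ∸ ℓ) * k →
  block ℓ k + ℓ * (m ∸ k * ℓ) + packed k (m ∸ k * ℓ) ≤ N-S₂ (B₂ r s m ℓ k)
block+packed≤B₂ r s m ℓ k ℓ≤r k≤s e≤ = ≤-trans (≤-reflexive value)
  (rows-≥ E ℓ k p q (<⇒≤ (m%n<n e k)) k≤s bound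
    (λ i< j<k → ∨ˡ (∧-true (<ᵇ-true i<) (<ᵇ-true j<k)))
    (λ {i} {j} _ i≡ j<q → ∨ʳ ((suc i ∈[ 1 , ℓ + p ]) ∧ (suc j ∈[ 1 , k ]))
      (∧-true (≡ᵇ-true (trans (cong suc i≡) (+-comm 1 (ℓ + p)))) (<ᵇ-true j<q))))
  where
  e = m ∸ k * ℓ
  p = e / k
  q = e % k
  E : ℕ → ℕ → Bool
  E i j = (i ∈[ 1 , ℓ + p ] ∧ j ∈[ 1 , k ]) ∨ ((i ≡ᵇ ℓ + p + 1) ∧ j ∈[ 1 , q ])
  bound : ℓ + p < r ⊎ (ℓ + p ≡ r × q ≡ 0)
  bound with quotient-bound e k (r ∸ ℓ) e≤
  ... | inj₁ p<        = inj₁ (≤-trans (+-monoʳ-< ℓ p<) (≤-reflexive (m+[n∸m]≡n ℓ≤r)))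
  ... | inj₂ (p≡ , q≡) = inj₂ (trans (cong (ℓ +_) p≡) (m+[n∸m]≡n ℓ≤r) , q≡)
  value : block ℓ k + ℓ * e + packed k e ≡ block ℓ k + ℓ * (p * k + q) + (p * tri k + k * tri p + tri q + p * q)
  value = cong₂ (λ x y → block ℓ k + ℓ * x + y) (m≡[m/n]*n+m%n e k) (packed-quotient k e)

-- Comparison of the bounds with the three extremal graphs

theorem1p7 : (r s ℓ k m : ℕ) .{{_ : NonZero r}} .{{_ : NonZero s}} .{{_ : NonZero ℓ}} .{{_ : NonZero k}} .{{_ : NonZero m}} →
    r ≥ s → ℓ ≥ k → r ≥ ℓ → s ≥ k → k * ℓ ≤ m → m ≤ r * s →
    (G : BipartiteGraph r s) →
    length (edges G) ≡ m →
    ∃[ I ] (∣ I ∣ ≡ ℓ × δU G I ≥ k) →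
    (m ≤ r * k → (k+ℓ≤r : k + ℓ ≤ r) → N-S₂ G ≤ N-S₂ (B₁ r s m ℓ k (k+ℓ≤r⇒ℓ<r k+ℓ≤r)))
    × (m ≤ r * k → k + ℓ > r → N-S₂ G ≤ N-S₂ (B₂ r s m ℓ k))
    × (m ≥ r * k → N-S₂ G ≤ N-S₂ (B r s m))
theorem1p7 r s ℓ k m r≥s ℓ≥k r≥ℓ s≥k kℓ≤m m≤rs G edges≡m (I , ∣I∣≡ℓ , δ≥k) = case₁ , case₂ , case₃
  where
  e = m ∸ k * ℓ
  kℓ+e≡m : k * ℓ + e ≡ m
  kℓ+e≡m = m+[n∸m]≡n kℓ≤m
  sum≡m : sum (degrees G) ≡ m
  sum≡m = trans (sym (length-edges G)) edges≡m

  -- The maximum stays a variable, so that it can become `r ∸ ℓ` in the first case and `k` in the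
  -- second.
  bound : ∀ n .{{_ : NonZero n}} → n ≡ (r ∸ ℓ) ⊔ k → m ≤ r * k →
    N-S₂ G ≤ block ℓ k + ℓ * e + packed n e
  bound n n≡ m≤rk = ≤-trans (N-S₂≤stars G) (stars-≤-block n n≡ (length-tabulate (degU G)) (degrees-≤ G) r≥s ℓ≥k
    (≤-trans (≤-reflexive (sym ∣I∣≡ℓ)) (∣I∣≤large-degrees G I δ≥k))
    (trans sum≡m (sym kℓ+e≡m)) (≤-trans (≤-reflexive kℓ+e≡m) m≤rk))

  e≤ : m ≤ r * k → e ≤ (r ∸ ℓ) * k
  e≤ m≤rk = +-cancelˡ-≤ (k * ℓ) _ _ (≤-trans (≤-reflexive kℓ+e≡m) (≤-trans m≤rk (≤-reflexive (begin
    r * k                    ≡⟨ cong (_* k) (m+[n∸m]≡n r≥ℓ) ⟨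
    (ℓ + (r ∸ ℓ)) * k        ≡⟨ *-distribʳ-+ k ℓ (r ∸ ℓ) ⟩
    ℓ * k + (r ∸ ℓ) * k      ≡⟨ cong (_+ (r ∸ ℓ) * k) (*-comm ℓ k) ⟩
    k * ℓ + (r ∸ ℓ) * k      ∎))))
    where open ≡-Reasoning

  case₁ : m ≤ r * k → (k+ℓ≤r : k + ℓ ≤ r) → N-S₂ G ≤ N-S₂ (B₁ r s m ℓ k (k+ℓ≤r⇒ℓ<r k+ℓ≤r))
  case₁ m≤rk k+ℓ≤r = ≤-trans (bound (r ∸ ℓ) (sym (m≥n⇒m⊔n≡m k≤r∸ℓ)) m≤rk)
    (block+packed≤B₁ r s m ℓ k (k+ℓ≤r⇒ℓ<r k+ℓ≤r) s≥k (≤-trans (e≤ m≤rk) (≤-reflexive (*-comm (r ∸ ℓ) k))))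
    where
    k≤r∸ℓ : k ≤ r ∸ ℓ
    k≤r∸ℓ = m+n≤o⇒m≤o∸n k k+ℓ≤r
    instance
      r∸ℓ≢0 : NonZero (r ∸ ℓ)
      r∸ℓ≢0 = >-nonZero (≤-trans (>-nonZero⁻¹ k) k≤r∸ℓ)

  case₂ : m ≤ r * k → k + ℓ > r → N-S₂ G ≤ N-S₂ (B₂ r s m ℓ k)
  case₂ m≤rk k+ℓ>r = ≤-trans (bound k (sym (m≤n⇒m⊔n≡n r∸ℓ≤k)) m≤rk) (block+packed≤B₂ r s m ℓ k r≥ℓ s≥k (e≤ m≤rk))
    where
    r∸ℓ≤k : r ∸ ℓ ≤ k
    r∸ℓ≤k = m≤n+o⇒m∸n≤o r ℓ (≤-trans (<⇒≤ k+ℓ>r) (≤-reflexive (+-comm k ℓ)))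

  case₃ : m ≥ r * k → N-S₂ G ≤ N-S₂ (B r s m)
  -- All degrees in U are at most `s`, hence at most `r`, so the whole diagram lies in an `r` by `r`
  -- box and is packed directly.
  case₃ _ = ≤-trans (N-S₂≤stars G) (≤-trans
    (stars-≤-packed r (≤-reflexive (length-tabulate (degU G))) (All.map (λ d≤s → ≤-trans d≤s r≥s) (degrees-≤ G)))
    (≤-trans (≤-reflexive (cong (packed r) sum≡m)) (packed≤B r s m (≤-trans m≤rs (≤-reflexive (*-comm r s))))))
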